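{- Let $H$ be a graph and let $G=KB(H)$ be its biclique graph. Let $q$ be a vertex of $G$ with degree $d(q)=2$. Then $G-\{q\}$ is a biclique graph; that is, there exists a graph $H'$ such that $G-\{q\}$ is isomorphic to $KB(H')$.
   Context: All graphs are finite, simple, undirected and connected. A biclique of a graph $H$ is a maximal (with respect to inclusion) set of vertices inducing a complete bipartite subgraph (with both parts nonempty). The biclique graph $KB(H)$ is the intersection graph of the family of all bicliques of $H$: its vertices are the bicliques of $H$, and two are adjacent iff they share at least one vertex. A graph $G$ is a biclique graph if $G\cong KB(H)$ for some graph $H$. $d(q)$ denotes the number of neighbours of $q$. -}

module Defs where

open import Data.Nat using (ℕ; suc)
open import Data.Bool using (Bool; true; false; if_then_else_; T)
open import Data.Fin using (Fin; punchIn)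
open import Data.Fin.Subset using (Subset; _∈_; _∉_; _⊆_; _∩_; Nonempty)
open import Data.List using (List; map; allFin)
open import Data.Nat.ListAction using (sum)
open import Data.Product using (Σ; ∃; _×_; _,_)
open import Data.Sum using (_⊎_)
open import Relation.Nullary using (¬_)
open import Relation.Binary.PropositionalEquality using (_≡_; _≢_)
open import Function.Bundles using (_⇔_)

record Graph (n : ℕ) : Set where
  field
    adj     : Fin n → Fin n → Bool
    symm    : ∀ u v → adj u v ≡ adj v u
    irrefl  : ∀ v → adj v v ≡ false

open Graph public

Adj : ∀ {n} → Graph n → Fin n → Fin n → Set
Adj G u v = T (adj G u v)

data Reach {n : ℕ} (G : Graph n) : Fin n → Fin n → Set where
  here : ∀ {u} → Reach G u u
  step : ∀ {u v w} → Adj G u v → Reach G v w → Reach G u w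

Connected : ∀ {n} → Graph n → Set
Connected {n} G = (u v : Fin n) → Reach G u v

degree : ∀ {n} → Graph n → Fin n → ℕ
degree {n} G q = sum (map (λ j → if adj G q j then 1 else 0) (allFin n))

delete : ∀ {m} → Graph (suc m) → Fin (suc m) → Graph m
delete G q = record
  { adj    = λ i j → adj G (punchIn q i) (punchIn q j)
  ; symm   = λ i j → symm G (punchIn q i) (punchIn q j)
  ; irrefl = λ i → irrefl G (punchIn q i)
  }

InducesCompleteBipartite : ∀ {n} → Graph n → Subset n → Set
InducesCompleteBipartite {n} H S =
  Σ (Subset n) λ X → Σ (Subset n) λ Y →
    ((v : Fin n) → (v ∈ S → v ∈ X ⊎ v ∈ Y) × (v ∈ X ⊎ v ∈ Y → v ∈ S))
  × ((v : Fin n) → v ∈ X → v ∉ Y)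
  × Nonempty X × Nonempty Y
  × ((x y : Fin n) → x ∈ X → y ∈ Y → Adj H x y)
  × ((x x′ : Fin n) → x ∈ X → x′ ∈ X → ¬ Adj H x x′)
  × ((y y′ : Fin n) → y ∈ Y → y′ ∈ Y → ¬ Adj H y y′)

IsBiclique : ∀ {n} → Graph n → Subset n → Set
IsBiclique {n} H S =
  InducesCompleteBipartite H S
  × ((S′ : Subset n) → S ⊆ S′ → InducesCompleteBipartite H S′ → S′ ⊆ S)

IsoKB : ∀ {m n} → Graph m → Graph n → Set
IsoKB {m} {n} G H =
  Σ (Fin m → Subset n) λ f →
    ((i j : Fin m) → f i ≡ f j → i ≡ j)
  × ((i : Fin m) → IsBiclique H (f i))
  × ((S : Subset n) → IsBiclique H S → ∃ λ i → f i ≡ S)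
  × ((i j : Fin m) → Adj G i j ⇔ (i ≢ j × Nonempty (f i ∩ f j)))

IsBicliqueGraph : ∀ {m} → Graph m → Set
IsBicliqueGraph G = Σ ℕ λ k → Σ (Graph k) λ H′ → Connected H′ × IsoKB G H′

-- A set of vertices containing an edge is complete bipartite iff adjacency on it
-- satisfies the cocycle identity adj u w = adj u v xor adj v w.  Let Q be the
-- biclique q; at most two others, a and b, meet it.
--
-- If some v outside Q forms a triangle with an edge x y of Q, then v x lies in a
-- and v y in b.  When v misses a vertex of Q, everything outside Q lies in a ∩ b,
-- so q, a, b are the only bicliques and the path on four vertices represents what
-- is left.  When v sees all of Q, deleting the edges inside Q and adding one new
-- vertex represents G - q.
--
-- Otherwise Q meets the rest of H in bipartite fashion.  If both sides of Q have
-- outer neighbours, or two outer neighbours have different traces on Q, every edge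
-- meets Q and again only q, a, b exist.  If all outer neighbours have the same
-- trace on one side of Q, that side folds onto one vertex of the trace, which kills
-- exactly the biclique q.
module Submission where

open import Defs
open import Data.Bool using (Bool; true; false; not; _∧_; _∨_; _xor_; if_then_else_; T)
  renaming (_≟_ to _≟ᵇ_)
open import Data.Bool.Properties
  using (T-≡; T?; ∧-comm; ∧-zeroʳ; ∧-identityʳ; ∨-comm; xor-comm; xor-same; xor-identityʳ)
open import Data.Empty using (⊥; ⊥-elim)
open import Data.Fin using (Fin; zero; suc; punchIn; punchOut; toℕ; _≟_)
open import Data.Fin.Properties
  using (any?; all?; punchIn-injective; punchInᵢ≢i; punchIn-punchOut)
open import Data.Fin.Subset using (Subset; _∈_; _∉_; _⊆_; _⊂_; ⊤)
open import Data.Fin.Subset.Induction using (⊃-wellFounded)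
open import Data.Fin.Subset.Properties
  using (_∈?_; _⊂?_; anySubset?; ⊆-antisym; ∈⊤; x∈p∩q⁺; x∈p∩q⁻)
open import Data.List using ([]; _∷_; map; filter; length; allFin)
open import Data.List.Membership.Propositional using () renaming (_∈_ to _∈ˡ_)
open import Data.List.Membership.Propositional.Properties using (∈-allFin; ∈-filter⁺; ∈-filter⁻)
open import Data.List.Relation.Unary.Any as Any using ()
open import Data.Nat using (ℕ; zero; suc; _≡ᵇ_)
open import Data.Nat.ListAction using (sum)
open import Data.Product using (∃; ∃₂; _×_; _,_; proj₁; proj₂)
open import Data.Sum using (_⊎_; inj₁; inj₂; [_,_]; swap)
open import Data.Vec using (tabulate; []; _∷_; here; there)
open import Data.Vec.Properties using (lookup∘tabulate; []=⇒lookup; lookup⇒[]=)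
open import Function using (_∘_; case_of_)
open import Function.Bundles using (mk⇔; Equivalence)
open import Induction.WellFounded using (Acc; acc)
open import Relation.Binary.PropositionalEquality
  using (_≡_; _≢_; refl; sym; trans; cong; cong₂; subst)
open import Relation.Nullary using (Dec; yes; no; does; ¬_; contradiction)
open import Relation.Nullary.Decidable
  using (dec-true; dec-false; map′; _×-dec_; _⊎-dec_; _→-dec_; ¬?; decidable-stable)

-- Booleans and decidable subsets.

bool-cases : (b : Bool) → b ≡ true ⊎ b ≡ false
bool-cases true  = inj₁ refl
bool-cases false = inj₂ refl

clash : ∀ {b} {A : Set} → b ≡ true → b ≡ false → A
clash refl ()

xor-telescope : ∀ a b c → a xor c ≡ (a xor b) xor (b xor c)
xor-telescope true  true  c = refl
xor-telescope true  false c = refl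
xor-telescope false true  true  = refl
xor-telescope false true  false = refl
xor-telescope false false c = refl

does-true : ∀ {A : Set} (a? : Dec A) → does a? ≡ true → A
does-true (yes a) _ = a

module _ {n} {P : Fin n → Set} (P? : ∀ u → Dec (P u)) where

  select : Subset n
  select = tabulate (does ∘ P?)

  ∈-select⁺ : ∀ {u} → P u → u ∈ select
  ∈-select⁺ {u} p = lookup⇒[]= u _ (trans (lookup∘tabulate _ u) (dec-true (P? u) p))

  ∈-select⁻ : ∀ {u} → u ∈ select → P u
  ∈-select⁻ {u} u∈ =
    does-true (P? u) (trans (sym (lookup∘tabulate (does ∘ P?) u)) ([]=⇒lookup u∈))

-- Complete bipartite sets and their maximal extensions.

-- On a complete bipartite set, adjacency is the xor of the sides; eliminating
-- the sides gives the cocycle identity.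
record CompleteBipartite {n} (H : Graph n) (S : Subset n) : Set where
  constructor completeBipartite
  field
    edge    : ∃₂ λ x y → x ∈ S × y ∈ S × adj H x y ≡ true
    cocycle : ∀ {u v w} → u ∈ S → v ∈ S → w ∈ S → adj H u w ≡ adj H u v xor adj H v w

  -- Parity inside one biclique: two adjacencies at `v` force the third. Later cases use it both to
  -- refute triangles and to produce edges.
  link : ∀ {u v w α β} → u ∈ S → v ∈ S → w ∈ S →
         adj H u v ≡ α → adj H v w ≡ β → adj H u w ≡ α xor β
  link u∈ v∈ w∈ p r = trans (cocycle u∈ v∈ w∈) (cong₂ _xor_ p r)

  neighbour : ∀ {u} → u ∈ S → ∃ λ z → z ∈ S × adj H u z ≡ true
  neighbour {u} u∈ with edge
  ... | x , y , x∈ , y∈ , x~y with bool-cases (adj H u x)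
  ...   | inj₁ u~x = x , x∈ , u~x
  ...   | inj₂ u≁x = y , y∈ , link u∈ x∈ y∈ u≁x x~y

open CompleteBipartite

completeBipartite? : ∀ {n} (H : Graph n) S → Dec (CompleteBipartite H S)
completeBipartite? H S = map′
  (λ (e , c) → completeBipartite e λ u∈ v∈ w∈ → c _ _ _ u∈ v∈ w∈)
  (λ cb → edge cb , λ _ _ _ → cocycle cb)
  ((any? λ x → any? λ y → x ∈? S ×-dec y ∈? S ×-dec adj H x y ≟ᵇ true)
   ×-dec
   (all? λ u → all? λ v → all? λ w → u ∈? S →-dec (v ∈? S →-dec (w ∈? S →-dec
     adj H u w ≟ᵇ (adj H u v xor adj H v w)))))

-- A two-colouring makes adjacency a coboundary, and the middle colour cancels in the xor.
fromSides : ∀ {n} {H : Graph n} {S} (side : Fin n → Bool) →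
  (∃₂ λ x y → x ∈ S × y ∈ S × adj H x y ≡ true) →
  (∀ {u v} → u ∈ S → v ∈ S → adj H u v ≡ side u xor side v) → CompleteBipartite H S
fromSides side e sides = completeBipartite e λ u∈ v∈ w∈ →
  trans (sides u∈ w∈) (trans (xor-telescope (side _) (side _) (side _))
    (sym (cong₂ _xor_ (sides u∈ v∈) (sides v∈ w∈))))

~-sym : ∀ {n} (H : Graph n) {u v b} → adj H u v ≡ b → adj H v u ≡ b
~-sym H {u} {v} = trans (symm H v u)

T⁺ : ∀ {b} → b ≡ true → T b
T⁺ = Equivalence.from T-≡

T⁻ : ∀ {b} → T b → b ≡ true
T⁻ = Equivalence.to T-≡

¬T⁺ : ∀ {b} → b ≡ false → ¬ T b
¬T⁺ refl ()

¬T⁻ : ∀ {b} → ¬ T b → b ≡ false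
¬T⁻ {true}  ¬t = contradiction _ ¬t
¬T⁻ {false} _  = refl

module _ {n} {H : Graph n} {S : Subset n} where

  induces⇒completeBipartite : InducesCompleteBipartite H S → CompleteBipartite H S
  induces⇒completeBipartite (X , Y , split , disj , (x , x∈) , (y , y∈) , XY , XX , YY) =
    fromSides (λ u → does (u ∈? X))
      (x , y , proj₂ (split x) (inj₁ x∈) , proj₂ (split y) (inj₂ y∈) , T⁻ (XY x y x∈ y∈))
      λ u∈ v∈ → sides (proj₁ (split _) u∈) (proj₁ (split _) v∈)
    where
    left : ∀ {u} → u ∈ X → does (u ∈? X) ≡ true
    left = dec-true (_ ∈? X)
    right : ∀ {u} → u ∈ Y → does (u ∈? X) ≡ false
    right u∈Y = dec-false (_ ∈? X) λ u∈X → disj _ u∈X u∈Y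
    sides : ∀ {u v} → u ∈ X ⊎ u ∈ Y → v ∈ X ⊎ v ∈ Y →
            adj H u v ≡ does (u ∈? X) xor does (v ∈? X)
    sides (inj₁ p) (inj₁ r) = trans (¬T⁻ (XX _ _ p r)) (sym (cong₂ _xor_ (left p) (left r)))
    sides (inj₁ p) (inj₂ r) = trans (T⁻ (XY _ _ p r)) (sym (cong₂ _xor_ (left p) (right r)))
    sides (inj₂ p) (inj₁ r) =
      trans (~-sym H (T⁻ (XY _ _ r p))) (sym (cong₂ _xor_ (right p) (left r)))
    sides (inj₂ p) (inj₂ r) = trans (¬T⁻ (YY _ _ p r)) (sym (cong₂ _xor_ (right p) (right r)))

  completeBipartite⇒induces : CompleteBipartite H S → InducesCompleteBipartite H S
  completeBipartite⇒induces cb with edge cb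
  ... | x , y , x∈ , y∈ , x~y =
    -- The sides are the neighbours and the non-neighbours of `y` in `S`.
    select (side? true) , select (side? false) ,
    (λ v → classify v ,
       [ proj₁ ∘ ∈-select⁻ (side? true) , proj₁ ∘ ∈-select⁻ (side? false) ]) ,
    (λ v p r → clash (proj₂ (∈-select⁻ (side? true) p)) (proj₂ (∈-select⁻ (side? false) r))) ,
    (x , ∈-select⁺ (side? true) (x∈ , x~y)) ,
    (y , ∈-select⁺ (side? false) (y∈ , irrefl H y)) ,
    (λ u v p r → T⁺ (between (∈-select⁻ (side? true) p) (∈-select⁻ (side? false) r))) ,
    (λ u v p r → ¬T⁺ (between (∈-select⁻ (side? true) p) (∈-select⁻ (side? true) r))) ,
    (λ u v p r → ¬T⁺ (between (∈-select⁻ (side? false) p) (∈-select⁻ (side? false) r)))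
    where
    side? : ∀ b u → Dec (u ∈ S × adj H u y ≡ b)
    side? b u = u ∈? S ×-dec adj H u y ≟ᵇ b
    classify : ∀ v → v ∈ S → v ∈ select (side? true) ⊎ v ∈ select (side? false)
    classify v v∈ with bool-cases (adj H v y)
    ... | inj₁ p = inj₁ (∈-select⁺ (side? true) (v∈ , p))
    ... | inj₂ p = inj₂ (∈-select⁺ (side? false) (v∈ , p))
    between : ∀ {u v α β} → u ∈ S × adj H u y ≡ α → v ∈ S × adj H v y ≡ β →
              adj H u v ≡ α xor β
    between (u∈ , p) (v∈ , r) = link cb u∈ y∈ v∈ p (~-sym H r)

module _ {n} {H : Graph n} where

  -- A set that is not maximal has a strictly larger complete bipartite set above it, and on
  -- finitely many vertices strict growth stops.
  extend : ∀ {S} → CompleteBipartite H S → ∃ λ S′ → S ⊆ S′ × IsBiclique H S′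
  extend {S} = go (⊃-wellFounded S)
    where
    go : ∀ {S} → Acc (λ S T → T ⊂ S) S → CompleteBipartite H S →
         ∃ λ S′ → S ⊆ S′ × IsBiclique H S′
    go {S} (acc rec) cb with anySubset? (λ S′ → S ⊂? S′ ×-dec completeBipartite? H S′)
    ... | yes (S′ , S⊂S′ , cb′) =
      let S″ , S′⊆S″ , b = go (rec S⊂S′) cb′ in S″ , S′⊆S″ ∘ proj₁ S⊂S′ , b
    ... | no maximal = S , (λ u∈ → u∈) , completeBipartite⇒induces cb ,
      λ S′ S⊆S′ icb {u} u∈S′ → decidable-stable (u ∈? S) λ u∉S →
        maximal (S′ , (S⊆S′ , u , u∈S′ , u∉S) , induces⇒completeBipartite icb)

-- Families of sets that realise a biclique graph.

Meet : ∀ {n} → Subset n → Subset n → Set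
Meet S S′ = ∃ λ u → u ∈ S × u ∈ S′

-- For an antichain of complete bipartite sets, covering every complete
-- bipartite set is the same as being the family of all bicliques.
record Represents {m n} (G : Graph m) (H : Graph n) (F : Fin m → Subset n) : Set where
  field
    bipartite : ∀ i → CompleteBipartite H (F i)
    antichain : ∀ {i j} → F i ⊆ F j → i ≡ j
    covers    : ∀ {S} → CompleteBipartite H S → ∃ λ i → S ⊆ F i
    adj⇒meet  : ∀ {i j} → adj G i j ≡ true → i ≢ j × Meet (F i) (F j)
    meet⇒adj  : ∀ {i j} → i ≢ j → Meet (F i) (F j) → adj G i j ≡ true

isoKB⇒represents : ∀ {m n} {G : Graph m} {H : Graph n} ((F , _) : IsoKB G H) → Represents G H F
isoKB⇒represents {G = G} {H} (F , inj , biclique , all , adjacency) = record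
  { bipartite = λ i → induces⇒completeBipartite (proj₁ (biclique i))
  ; antichain = λ {i} {j} i⊆j → inj i j (⊆-antisym i⊆j
      (proj₂ (biclique i) (F j) i⊆j (proj₁ (biclique j))))
  ; covers    = λ cb → let S , ⊆S , b = extend cb; i , eq = all S b
                       in i , λ {u} u∈ → subst (u ∈_) (sym eq) (⊆S u∈)
  ; adj⇒meet  = λ {i} {j} i~j → let i≢j , u , u∈ = Equivalence.to (adjacency i j) (T⁺ i~j)
                                in i≢j , u , x∈p∩q⁻ (F i) (F j) u∈
  ; meet⇒adj  = λ {i} {j} i≢j (u , u∈) →
      T⁻ (Equivalence.from (adjacency i j) (i≢j , u , x∈p∩q⁺ u∈))
  }

-- Maximality comes back from the covering: a complete bipartite set above `F i` lies in some `F j`,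
-- and the antichain condition gives `i ≡ j`.
represents⇒isoKB : ∀ {m n} {G : Graph m} {H : Graph n} {F} → Represents G H F → IsoKB G H
represents⇒isoKB {G = G} {H} {F} R =
  F ,
  (λ i j eq → antichain (λ {u} → subst (u ∈_) eq)) ,
  (λ i → completeBipartite⇒induces (bipartite i) , λ S i⊆S icb {u} u∈S →
    let j , S⊆j = covers (induces⇒completeBipartite icb)
    in subst (λ k → u ∈ F k) (sym (antichain (S⊆j ∘ i⊆S))) (S⊆j u∈S)) ,
  (λ S (icb , maximal) →
    let i , S⊆i = covers (induces⇒completeBipartite icb)
    in i , ⊆-antisym (maximal (F i) S⊆i (completeBipartite⇒induces (bipartite i))) S⊆i) ,
  λ i j → mk⇔
    (λ i~j → let i≢j , u , u∈ = adj⇒meet (T⁻ i~j) in i≢j , u , x∈p∩q⁺ u∈)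
    (λ (i≢j , u , u∈) → T⁺ (meet⇒adj i≢j (u , x∈p∩q⁻ (F i) (F j) u∈)))
  where open Represents R

meet-sym : ∀ {n} {S S′ : Subset n} → Meet S S′ → Meet S′ S
meet-sym (u , u∈ , u∈′) = u , u∈′ , u∈

-- Reachability and the path on four vertices.

reach-trans : ∀ {n} {H : Graph n} {u v w} → Reach H u v → Reach H v w → Reach H u w
reach-trans here       r = r
reach-trans (step a p) r = step a (reach-trans p r)

reach-sym : ∀ {n} (H : Graph n) {u v} → Reach H u v → Reach H v u
reach-sym H here       = here
reach-sym H (step {u} {v} a r) = reach-trans (reach-sym H r) (step (subst T (symm H u v) a) here)

-- Its bicliques are the two paths on three vertices, which share the middle edge, so its biclique
-- graph is a single edge.
P₄ : Graph 4
P₄ = record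
  { adj    = λ u v → (toℕ u ≡ᵇ suc (toℕ v)) ∨ (toℕ v ≡ᵇ suc (toℕ u))
  ; symm   = λ u v → ∨-comm (toℕ u ≡ᵇ suc (toℕ v)) _
  ; irrefl = λ where
      zero                   → refl
      (suc zero)             → refl
      (suc (suc zero))       → refl
      (suc (suc (suc zero))) → refl
  }

P₄-connected : Connected P₄
P₄-connected u v = reach-trans (toOrigin u) (reach-sym P₄ (toOrigin v))
  where
  from-1 : Reach P₄ (suc zero) zero
  from-1 = step {v = zero} _ here
  from-2 : Reach P₄ (suc (suc zero)) zero
  from-2 = step {v = suc zero} _ from-1
  toOrigin : ∀ u → Reach P₄ u zero
  toOrigin zero                   = here
  toOrigin (suc zero)             = from-1
  toOrigin (suc (suc zero))       = from-2
  toOrigin (suc (suc (suc zero))) = step {v = suc (suc zero)} _ from-2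

initial final : Subset 4
initial = true ∷ true ∷ true ∷ false ∷ []
final   = false ∷ true ∷ true ∷ true ∷ []

P₄-covers : ∀ {S} → CompleteBipartite P₄ S → S ⊆ initial ⊎ S ⊆ final
P₄-covers {S} cb with zero ∈? S | suc (suc (suc zero)) ∈? S
... | no 0∉ | _ = inj₂ ⊆final
  where
  ⊆final : S ⊆ final
  ⊆final {zero}                 u∈ = contradiction u∈ 0∉
  ⊆final {suc zero}             _  = there here
  ⊆final {suc (suc zero)}       _  = there (there here)
  ⊆final {suc (suc (suc zero))} _  = there (there (there here))
... | yes _ | no 3∉ = inj₁ ⊆initial
  where
  ⊆initial : S ⊆ initial
  ⊆initial {zero}                 _  = here
  ⊆initial {suc zero}             _  = there here
  ⊆initial {suc (suc zero)}       _  = there (there here)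
  ⊆initial {suc (suc (suc zero))} u∈ = contradiction u∈ 3∉
... | yes 0∈ | yes 3∈ with neighbour cb 0∈
-- Vertex 1 is the only neighbour of 0. Since 1 is not adjacent to 3, the cocycle identity would
-- make 0 adjacent to 3.
...   | suc zero             , 1∈ , _ = case cocycle cb 0∈ 1∈ 3∈ of λ ()

-- Constructions that represent the graph without `q`.

module Deletion {n m} {H : Graph n} {G : Graph (suc m)} {F : Fin (suc m) → Subset n}
                (R : Represents G H F) (q : Fin (suc m)) where
  open Represents R

  -- The value F′ q is junk and no hypothesis mentions it.
  deletion-isBicliqueGraph : ∀ {k} (H′ : Graph k) → Connected H′ →
    (F′ : Fin (suc m) → Subset k) →
    (∀ {i} → i ≢ q → CompleteBipartite H′ (F′ i)) →
    (∀ {i j} → i ≢ q → j ≢ q → F′ i ⊆ F′ j → i ≡ j) →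
    (∀ {S} → CompleteBipartite H′ S → ∃ λ i → i ≢ q × S ⊆ F′ i) →
    (∀ {i j} → i ≢ q → j ≢ q → i ≢ j → Meet (F i) (F j) → Meet (F′ i) (F′ j)) →
    (∀ {i j} → i ≢ q → j ≢ q → i ≢ j → Meet (F′ i) (F′ j) → Meet (F i) (F j)) →
    IsBicliqueGraph (delete G q)
  deletion-isBicliqueGraph H′ conn F′ cb anti cov meet⁺ meet⁻ =
    _ , H′ , conn , represents⇒isoKB {G = delete G q} {F = F′ ∘ punchIn q} record
      { bipartite = λ i → cb (punchInᵢ≢i q i)
      ; antichain = λ i⊆j →
          punchIn-injective q _ _ (anti (punchInᵢ≢i q _) (punchInᵢ≢i q _) i⊆j)
      ; covers    = λ {S} cbS →
          let i , i≢q , S⊆ = cov cbS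
          in punchOut (i≢q ∘ sym) ,
             λ {u} u∈ → subst (λ j → u ∈ F′ j) (sym (punchIn-punchOut (i≢q ∘ sym))) (S⊆ u∈)
      ; adj⇒meet  = λ i~j →
          let i≢j , common = adj⇒meet i~j
          in i≢j ∘ cong (punchIn q) , meet⁺ (punchInᵢ≢i q _) (punchInᵢ≢i q _) i≢j common
      ; meet⇒adj  = λ i≢j common →
          let i≢j′ = i≢j ∘ punchIn-injective q _ _
          in meet⇒adj i≢j′ (meet⁻ (punchInᵢ≢i q _) (punchInᵢ≢i q _) i≢j′ common)
      }

  three-bicliques : ∀ {a b} → a ≢ q → b ≢ q → a ≢ b → Meet (F a) (F b) →
    (∀ i → i ≢ q → i ≡ a ⊎ i ≡ b) → IsBicliqueGraph (delete G q)
  three-bicliques {a} {b} a≢q b≢q a≢b common only =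
    deletion-isBicliqueGraph P₄ P₄-connected F′ (λ {i} _ → cb i) anti cov
      (λ {i} {j} _ _ _ _ → suc zero , one∈ i , one∈ j) meet⁻
    where
    F′ : Fin (suc m) → Subset 4
    -- The `else` branch is meant for `b`; it also gives the arbitrary value at `q`.
    F′ i = if does (i ≟ a) then initial else final
    F′a : F′ a ≡ initial
    F′a = cong (λ c → if c then initial else final) (dec-true (a ≟ a) refl)
    F′b : F′ b ≡ final
    F′b = cong (λ c → if c then initial else final) (dec-false (b ≟ a) (a≢b ∘ sym))
    cb : ∀ i → CompleteBipartite P₄ (F′ i)
    cb i with does (i ≟ a)
    ... | true  = does-true (completeBipartite? P₄ initial) refl
    ... | false = does-true (completeBipartite? P₄ final) refl
    one∈ : ∀ i → suc zero ∈ F′ i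
    one∈ i with does (i ≟ a)
    ... | true  = there here
    ... | false = there here
    anti : ∀ {i j} → i ≢ q → j ≢ q → F′ i ⊆ F′ j → i ≡ j
    anti {i} {j} i≢q j≢q i⊆j with only i i≢q | only j j≢q
    ... | inj₁ i≡a  | inj₁ j≡a  = trans i≡a (sym j≡a)
    ... | inj₂ i≡b  | inj₂ j≡b  = trans i≡b (sym j≡b)
    ... | inj₁ refl | inj₂ refl =
      contradiction (subst (zero ∈_) F′b (i⊆j (subst (zero ∈_) (sym F′a) here))) λ ()
    ... | inj₂ refl | inj₁ refl =
      contradiction (subst (suc (suc (suc zero)) ∈_) F′a
        (i⊆j (subst (suc (suc (suc zero)) ∈_) (sym F′b) (there (there (there here))))))
        λ where (there (there (there ())))
    cov : ∀ {S} → CompleteBipartite P₄ S → ∃ λ i → i ≢ q × S ⊆ F′ i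
    cov cbS with P₄-covers cbS
    ... | inj₁ S⊆ = a , a≢q , λ {u} u∈ → subst (u ∈_) (sym F′a) (S⊆ u∈)
    ... | inj₂ S⊆ = b , b≢q , λ {u} u∈ → subst (u ∈_) (sym F′b) (S⊆ u∈)
    meet⁻ : ∀ {i j} → i ≢ q → j ≢ q → i ≢ j → Meet (F′ i) (F′ j) → Meet (F i) (F j)
    meet⁻ {i} {j} i≢q j≢q i≢j _ with only i i≢q | only j j≢q
    ... | inj₁ refl | inj₁ refl = contradiction refl i≢j
    ... | inj₁ refl | inj₂ refl = common
    ... | inj₂ refl | inj₁ refl = meet-sym common
    ... | inj₂ refl | inj₂ refl = contradiction refl i≢j

  -- `ρ` may identify vertices: an edge and the cocycle identity both pass to the image of `S`,
  -- which is then a complete bipartite set of `H`.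
  image-covered : ∀ {k} {H′ : Graph k} {S : Subset k} (ρ : Fin k → Fin n) →
    (∀ {s t} → s ∈ S → t ∈ S → adj H′ s t ≡ adj H (ρ s) (ρ t)) →
    CompleteBipartite H′ S → ∃ λ i → ∀ {s} → s ∈ S → ρ s ∈ F i
  image-covered {H′ = H′} {S} ρ preserves cb =
    let i , ⊆i = covers image-cb in i , λ s∈ → ⊆i (ρ∈ s∈)
    where
    image? : ∀ u → Dec (∃ λ s → s ∈ S × ρ s ≡ u)
    image? u = any? λ s → s ∈? S ×-dec ρ s ≟ u
    ρ∈ : ∀ {s} → s ∈ S → ρ s ∈ select image?
    ρ∈ s∈ = ∈-select⁺ image? (_ , s∈ , refl)
    image-cb : CompleteBipartite H (select image?)
    image-cb =
      let x , y , x∈ , y∈ , x~y = edge cb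
      in completeBipartite (_ , _ , ρ∈ x∈ , ρ∈ y∈ , trans (sym (preserves x∈ y∈)) x~y)
      λ u∈ v∈ w∈ → case ∈-select⁻ image? u∈ , ∈-select⁻ image? v∈ , ∈-select⁻ image? w∈ of λ where
        ((r , r∈ , refl) , (s , s∈ , refl) , (t , t∈ , refl)) →
          trans (sym (preserves r∈ t∈)) (trans (cocycle cb r∈ s∈ t∈)
            (cong₂ _xor_ (preserves r∈ s∈) (preserves s∈ t∈)))

  -- Pulling adjacency back along `π` makes each `u` a twin of `π u`, so complete bipartite sets of
  -- `H′` lie in preimages of bicliques of `H`. Bicliques other than `q` are fixed pointwise and
  -- survive; the fixed part of `q` lies in `a`, so the preimage of `q` is absorbed.
  folding : (π : Fin n → Fin n) → (∀ u → π (π u) ≡ π u) →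
    (∀ {u v} → adj H u v ≡ true → adj H (π u) (π v) ≡ true) → Connected H →
    (∀ {i u} → i ≢ q → u ∈ F i → π u ≡ u) →
    (∃ λ a → a ≢ q × (∀ {u} → u ∈ F q → π u ≡ u → u ∈ F a)) →
    IsBicliqueGraph (delete G q)
  folding π idem hom conn fixed (a , a≢q , q⊆a) =
    deletion-isBicliqueGraph H′ (λ u v → reach (conn u v)) F′ cb anti cov meet⁺ meet⁻
    where
    H′ : Graph n
    H′ = record
      { adj    = λ u v → adj H (π u) (π v)
      ; symm   = λ u v → symm H (π u) (π v)
      ; irrefl = λ u → irrefl H (π u)
      }
    reach : ∀ {u v} → Reach H u v → Reach H′ u v
    reach here       = here
    reach (step a r) = step (T⁺ (hom (T⁻ a))) (reach r)
    π∈? : ∀ i u → Dec (π u ∈ F i)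
    π∈? i u = π u ∈? F i
    F′ : Fin (suc m) → Subset n
    F′ i = select (π∈? i)
    restore : ∀ {i u} → i ≢ q → u ∈ F i → u ∈ F′ i
    restore {i} i≢q u∈ =
      ∈-select⁺ (π∈? i) (subst (_∈ F i) (sym (fixed i≢q u∈)) u∈)
    cb : ∀ {i} → i ≢ q → CompleteBipartite H′ (F′ i)
    cb {i} i≢q =
      let x , y , x∈ , y∈ , x~y = edge (bipartite i)
      in completeBipartite (x , y , restore i≢q x∈ , restore i≢q y∈ , hom x~y)
      λ u∈ v∈ w∈ → cocycle (bipartite i)
        (∈-select⁻ (π∈? i) u∈) (∈-select⁻ (π∈? i) v∈) (∈-select⁻ (π∈? i) w∈)
    anti : ∀ {i j} → i ≢ q → j ≢ q → F′ i ⊆ F′ j → i ≡ j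
    anti {i} {j} i≢q j≢q i⊆j = antichain λ u∈ →
      subst (_∈ F j) (fixed i≢q u∈) (∈-select⁻ (π∈? j) (i⊆j (restore i≢q u∈)))
    cov : ∀ {S} → CompleteBipartite H′ S → ∃ λ i → i ≢ q × S ⊆ F′ i
    cov cbS with image-covered {H′ = H′} π (λ _ _ → refl) cbS
    ... | i , S⊆ with i ≟ q
    -- Values of `π` are fixed points by idempotence, so those in `Q` lie in `F a`.
    ...   | yes refl = a , a≢q , λ u∈ → ∈-select⁺ (π∈? a) (q⊆a (S⊆ u∈) (idem _))
    ...   | no i≢q   = i , i≢q , λ u∈ → ∈-select⁺ (π∈? i) (S⊆ u∈)
    meet⁺ : ∀ {i j} → i ≢ q → j ≢ q → i ≢ j → Meet (F i) (F j) → Meet (F′ i) (F′ j)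
    meet⁺ i≢q j≢q _ (u , u∈ , u∈′) = u , restore i≢q u∈ , restore j≢q u∈′
    meet⁻ : ∀ {i j} → i ≢ q → j ≢ q → i ≢ j → Meet (F′ i) (F′ j) → Meet (F i) (F j)
    meet⁻ {i} {j} _ _ _ (u , u∈ , u∈′) =
      π u , ∈-select⁻ (π∈? i) u∈ , ∈-select⁻ (π∈? j) u∈′

  -- The leaves may coincide, which covers an edge.  Abstract because normalising
  -- this proof in with-abstractions is slow.
  abstract
    cherry : ∀ {c l r} → adj H c l ≡ true → adj H c r ≡ true → adj H l r ≡ false →
      ∃ λ i → c ∈ F i × l ∈ F i × r ∈ F i
    cherry {c} {l} {r} c~l c~r l≁r =
      let i , ∈i = image-covered {H′ = P₃} {⊤} ρ (λ {s} {t} _ _ → preserves s t)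
                     (does-true (completeBipartite? P₃ ⊤) refl)
      in i , ∈i {zero} ∈⊤ , ∈i {suc zero} ∈⊤ , ∈i {suc (suc zero)} ∈⊤
      where
      isCentre : Fin 3 → Bool
      isCentre zero    = true
      isCentre (suc _) = false
      P₃ : Graph 3
      P₃ = record
        { adj    = λ u v → isCentre u xor isCentre v
        ; symm   = λ u v → xor-comm (isCentre u) (isCentre v)
        ; irrefl = λ u → xor-same (isCentre u)
        }
      ρ : Fin 3 → Fin n
      ρ zero             = c
      ρ (suc zero)       = l
      ρ (suc (suc zero)) = r
      preserves : ∀ s t → adj P₃ s t ≡ adj H (ρ s) (ρ t)
      preserves zero             zero             = sym (irrefl H c)
      preserves zero             (suc zero)       = sym c~l
      preserves zero             (suc (suc zero)) = sym c~r
      preserves (suc zero)       zero             = sym (~-sym H c~l)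
      preserves (suc zero)       (suc zero)       = sym (irrefl H l)
      preserves (suc zero)       (suc (suc zero)) = sym l≁r
      preserves (suc (suc zero)) zero             = sym (~-sym H c~r)
      preserves (suc (suc zero)) (suc zero)       = sym (~-sym H l≁r)
      preserves (suc (suc zero)) (suc (suc zero)) = sym (irrefl H r)

  -- The biclique `Q` and the two bicliques around it.

  Q : Subset n
  Q = F q

  _~_ _≁_ : Fin n → Fin n → Set
  u ~ v = adj H u v ≡ true
  u ≁ v = adj H u v ≡ false

  flip-adj : ∀ {u v b} → adj H u v ≡ b → adj H v u ≡ b
  flip-adj = ~-sym H

  linkIn : ∀ {i u v w α β} → u ∈ F i → v ∈ F i → w ∈ F i →
           adj H u v ≡ α → adj H v w ≡ β → adj H u w ≡ α xor β
  linkIn {i} = link (bipartite i)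

  away : ∀ {i u} → u ∉ Q → u ∈ F i → i ≢ q
  away u∉Q u∈ refl = u∉Q u∈

  reach-closed : (P : Fin n → Set) → (∀ {u v} → P u → u ~ v → P v) →
                 ∀ {u v} → Reach H u v → P u → P v
  reach-closed P closed here       p = p
  reach-closed P closed (step a r) p = reach-closed P closed r (closed p (T⁻ a))

  -- The degree hypothesis seen from `H`: only `q`, `a` and `b` can reach into `Q`.
  record Near (a b : Fin (suc m)) : Set where
    field
      a≢q    : a ≢ q
      b≢q    : b ≢ q
      a≢b    : a ≢ b
      locate : ∀ {i u} → u ∈ Q → u ∈ F i → i ≢ q → i ≡ a ⊎ i ≡ b

  near-sym : ∀ {a b} → Near a b → Near b a
  near-sym N = record
    { a≢q = b≢q ; b≢q = a≢q ; a≢b = a≢b ∘ sym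
    ; locate = λ u∈Q u∈ i≢q → swap (locate u∈Q u∈ i≢q) }
    where open Near N

  Some : (Fin n → Set) → Fin n → Fin n → Fin n → Set
  Some P c l r = P c ⊎ P l ⊎ P r

  All : (Fin n → Set) → Fin n → Fin n → Fin n → Set
  All P c l r = P c × P l × P r

  some-all : ∀ {P P′ : Fin n → Set} {c l r} → Some P c l r → All P′ c l r → ∃ λ u → P u × P′ u
  some-all (inj₁ p)        (p′ , _)     = _ , p , p′
  some-all (inj₂ (inj₁ p)) (_ , p′ , _) = _ , p , p′
  some-all (inj₂ (inj₂ p)) (_ , _ , p′) = _ , p , p′

  -- Some biclique contains the cherry. Its vertex outside `Q` shows that this is not `q`, and its
  -- vertex in `Q` then leaves only `a` and `b`.
  fork : ∀ {a b c l r} → Near a b → Some (_∈ Q) c l r → Some (_∉ Q) c l r →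
         c ~ l → c ~ r → l ≁ r → All (_∈ F a) c l r ⊎ All (_∈ F b) c l r
  fork N some∈ some∉ c~l c~r l≁r with cherry c~l c~r l≁r
  ... | i , ∈i with some-all {_∈ Q} {_∈ F i} some∈ ∈i | some-all {_∉ Q} {_∈ F i} some∉ ∈i
  ...   | u , u∈Q , u∈i | w , w∉Q , w∈i
    with Near.locate N u∈Q u∈i (away w∉Q w∈i)
  ...     | inj₁ refl = inj₁ ∈i
  ...     | inj₂ refl = inj₂ ∈i

  joint : ∀ {a b u w} → Near a b → u ∈ Q → w ∉ Q → u ~ w →
          (u ∈ F a × w ∈ F a) ⊎ (u ∈ F b × w ∈ F b)
  joint N u∈Q w∉Q u~w with fork N (inj₁ u∈Q) (inj₂ (inj₁ w∉Q)) u~w u~w (irrefl H _)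
  ... | inj₁ (u∈ , w∈ , _) = inj₁ (u∈ , w∈)
  ... | inj₂ (u∈ , w∈ , _) = inj₂ (u∈ , w∈)

  meets-Q? : ∀ i → Dec (Meet (F i) Q)
  meets-Q? i = any? λ u → u ∈? F i ×-dec u ∈? Q

  three-near-bicliques : ∀ {a b} → Near a b → Meet (F a) (F b) →
    (∀ i → i ≢ q → ¬ Meet (F i) Q → ⊥) → IsBicliqueGraph (delete G q)
  three-near-bicliques {a} {b} N common none = three-bicliques a≢q b≢q a≢b common only
    where
    open Near N
    only : ∀ i → i ≢ q → i ≡ a ⊎ i ≡ b
    only i i≢q with meets-Q? i
    ... | yes (u , u∈ , u∈Q) = locate u∈Q u∈ i≢q
    ... | no apart           = ⊥-elim (none i i≢q apart)

  -- By connectivity the hypothesis keeps every vertex within distance one of `Q`, and then leaves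
  -- no edge outside `Q`. A biclique contains an edge, so it meets `Q`.
  no-outer-edge : ∀ {a b} → Connected H → Near a b → Meet (F a) (F b) →
    (∀ {z s t} → z ∈ Q → s ~ z → s ∉ Q → t ∉ Q → s ~ t → ⊥) → IsBicliqueGraph (delete G q)
  no-outer-edge conn N common free = three-near-bicliques N common impossible
    where
    Close : Fin n → Set
    Close u = u ∈ Q ⊎ ∃ λ z → z ∈ Q × u ~ z
    close : ∀ u → Close u
    close u = reach-closed Close spread (conn _ u) (inj₁ q-inhabited)
      where
      q-inhabited : proj₁ (edge (bipartite q)) ∈ Q
      q-inhabited = proj₁ (proj₂ (proj₂ (edge (bipartite q))))
      spread : ∀ {u v} → Close u → u ~ v → Close v
      spread {u} {v} p u~v with u ∈? Q | v ∈? Q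
      ... | _       | yes v∈Q = inj₁ v∈Q
      ... | yes u∈Q | no _    = inj₂ (u , u∈Q , flip-adj u~v)
      ... | no u∉Q  | no v∉Q  with p
      ...   | inj₁ u∈Q              = contradiction u∈Q u∉Q
      ...   | inj₂ (z , z∈Q , u~z) = ⊥-elim (free z∈Q u~z u∉Q v∉Q u~v)
    impossible : ∀ i → i ≢ q → ¬ Meet (F i) Q → ⊥
    impossible i _ apart with edge (bipartite i)
    ... | s , t , s∈ , t∈ , s~t with close s
    ...   | inj₁ s∈Q              = apart (s , s∈ , s∈Q)
    ...   | inj₂ (z , z∈Q , s~z) =
      free z∈Q s~z (λ s∈Q → apart (s , s∈ , s∈Q)) (λ t∈Q → apart (t , t∈ , t∈Q)) s~t

  -- On `P` the outer vertex `v` behaves like `y`, so adjacency to `y` colours `P` together with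
  -- `v`. A biclique above that set contains `v` and so differs from `q`.
  attach : ∀ {P : Fin n → Set} {v x y} (P? : ∀ u → Dec (P u)) → (∀ {u} → P u → u ∈ Q) →
    y ∈ Q → v ∉ Q → (∀ {u} → P u → adj H v u ≡ adj H u y) → P x → x ~ y → v ≁ y →
    ∃ λ i → i ≢ q × (∀ {u} → P u → u ∈ F i)
  attach {P} {v} {x} {y} P? P⊆Q y∈Q v∉Q like-y px x~y v≁y =
    let i , ⊆i = covers cb
    in i , away v∉Q (⊆i (∈-select⁺ Pv? (inj₂ refl))) ,
       λ p → ⊆i (∈-select⁺ Pv? (inj₁ p))
    where
    Pv? : ∀ u → Dec (P u ⊎ u ≡ v)
    Pv? u = P? u ⊎-dec u ≟ v
    sides : ∀ {u w} → P u ⊎ u ≡ v → P w ⊎ w ≡ v → adj H u w ≡ adj H u y xor adj H w y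
    sides (inj₁ p)    (inj₁ r)    = linkIn (P⊆Q p) y∈Q (P⊆Q r) refl (symm H y _)
    sides {u} (inj₁ p) (inj₂ refl) = trans (flip-adj (like-y p))
      (trans (sym (xor-identityʳ (adj H u y))) (cong (adj H u y xor_) (sym v≁y)))
    sides {w = w} (inj₂ refl) (inj₁ r) = trans (like-y r) (cong (_xor adj H w y) (sym v≁y))
    sides (inj₂ refl) (inj₂ refl) = trans (irrefl H v) (sym (xor-same (adj H v y)))
    cb : CompleteBipartite H (select Pv?)
    cb = fromSides (λ u → adj H u y)
      (v , x , ∈-select⁺ Pv? (inj₂ refl) , ∈-select⁺ Pv? (inj₁ px) , trans (like-y px) x~y)
      λ u∈ w∈ → sides (∈-select⁻ Pv? u∈) (∈-select⁻ Pv? w∈)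

  -- A triangle over an edge of Q

  -- The edge below a triangle `v x y`: `a` is to contain `v x` and `b` to contain `v y`. Neither
  -- can contain the whole triangle, whence the two exclusions.
  record Base (a b : Fin (suc m)) (x y : Fin n) : Set where
    field
      near : Near a b
      x∈Q  : x ∈ Q
      y∈Q  : y ∈ Q
      x~y  : x ~ y
      x∈a  : x ∈ F a
      y∈b  : y ∈ F b
      x∉b  : x ∉ F b
      y∉a  : y ∉ F a
    open Near near public

  record Roof (a b : Fin (suc m)) (x y v : Fin n) : Set where
    field
      v∉Q : v ∉ Q
      v~x : v ~ x
      v~y : v ~ y
      v∈a : v ∈ F a
      v∈b : v ∈ F b

  base-sym : ∀ {a b x y} → Base a b x y → Base b a y x
  base-sym B = record
    { near = near-sym near ; x∈Q = y∈Q ; y∈Q = x∈Q ; x~y = flip-adj x~y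
    ; x∈a = y∈b ; y∈b = x∈a ; x∉b = y∉a ; y∉a = x∉b }
    where open Base B

  roof-sym : ∀ {a b x y v} → Roof a b x y v → Roof b a y x v
  roof-sym V = record { v∉Q = v∉Q ; v~x = v~y ; v~y = v~x ; v∈a = v∈b ; v∈b = v∈a }
    where open Roof V

  module _ {a b x y v} (B : Base a b x y) (V : Roof a b x y v) where
    open Base B
    open Roof V

    -- An edge `u x` would lie in `a`, since `x` is not in `b`, and make a triangle there with `v`.
    -- Without it, `v` with leaves `u` and `x` is a cherry, which must lie in `a` for the same
    -- reason.
    roof-neighbour : ∀ {u} → u ∉ Q → v ~ u → u ≁ x × u ∈ F a
    roof-neighbour {u} u∉Q v~u with bool-cases (adj H u x)
    ... | inj₁ u~x with joint near x∈Q u∉Q (flip-adj u~x)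
    ...   | inj₁ (_ , u∈a) = clash v~x (linkIn v∈a u∈a x∈a v~u u~x)
    ...   | inj₂ (x∈b , _) = contradiction x∈b x∉b
    roof-neighbour {u} u∉Q v~u | inj₂ u≁x
      with fork near (inj₂ (inj₂ x∈Q)) (inj₁ v∉Q) v~u v~x u≁x
    ...   | inj₁ (_ , u∈a , _) = u≁x , u∈a
    ...   | inj₂ (_ , _ , x∈b) = contradiction x∈b x∉b

  module _ {a b x y v} (B : Base a b x y) (V : Roof a b x y v) where
    open Base B
    open Roof V

    -- If `s` misses `x`, parity in `a` gives an edge to `v`. If `s` sees `x`, it must see `y` too,
    -- since a cherry with leaves `s` and `y` fits neither biclique. Thus `a` and `b` agree outside
    -- `Q`.
    outer : ∀ {s} → s ∉ Q → s ∈ F a → s ∈ F b × (Roof a b x y s ⊎ v ~ s)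
    outer {s} s∉Q s∈a with bool-cases (adj H s x) | bool-cases (adj H s y)
    ... | inj₂ s≁x | _ =
      let v~s = flip-adj (linkIn s∈a x∈a v∈a s≁x (flip-adj v~x))
      in proj₂ (roof-neighbour (base-sym B) (roof-sym V) s∉Q v~s) , inj₂ v~s
    ... | inj₁ s~x | inj₂ s≁y
      with fork near (inj₁ x∈Q) (inj₂ (inj₁ s∉Q)) (flip-adj s~x) x~y s≁y
    ...   | inj₁ (_ , _ , y∈a) = contradiction y∈a y∉a
    ...   | inj₂ (x∈b , _)     = contradiction x∈b x∉b
    outer {s} s∉Q s∈a | inj₁ s~x | inj₁ s~y with joint near y∈Q s∉Q (flip-adj s~y)
    ...   | inj₁ (y∈a , _) = contradiction y∈a y∉a
    ...   | inj₂ (_ , s∈b) = s∈b , inj₁ record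
      { v∉Q = s∉Q ; v~x = s~x ; v~y = s~y ; v∈a = s∈a ; v∈b = s∈b }

  module _ {a b x y v} (B : Base a b x y) (V : Roof a b x y v) where
    open Base B
    open Roof V

    outer-either : ∀ {s} → s ∉ Q → s ∈ F a ⊎ s ∈ F b →
                   s ∈ F a × s ∈ F b × (Roof a b x y s ⊎ v ~ s)
    outer-either s∉Q (inj₁ s∈a) = s∈a , outer B V s∉Q s∈a
    outer-either s∉Q (inj₂ s∈b) with outer (base-sym B) (roof-sym V) s∉Q s∈b
    ... | s∈a , inj₁ S   = s∈a , s∈b , inj₁ (roof-sym S)
    ... | s∈a , inj₂ v~s = s∈a , s∈b , inj₂ v~s

    -- If the roof misses a vertex of Q then nothing lies outside Q ∪ (a ∩ b).
    dented : Connected H → ∀ {p} → p ∈ Q → p ~ y → v ≁ p → IsBicliqueGraph (delete G q)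
    dented conn {p} p∈Q p~y v≁p =
      three-near-bicliques near (v , v∈a , v∈b) λ i _ apart →
        -- A biclique disjoint from `Q` would lie inside `a`, hence equal `a`, which contains `x`.
        let i⊆a : F i ⊆ F a
            i⊆a {u} u∈ = [ (λ u∈Q → contradiction (u , u∈ , u∈Q) apart) , proj₁ ] (everywhere u)
        in apart (x , subst (λ j → x ∈ F j) (sym (antichain i⊆a)) x∈a , x∈Q)
      where
      Inside : Fin n → Set
      Inside u = u ∈ Q ⊎ (u ∈ F a × u ∈ F b)

      inside : ∀ {s} → s ∉ Q → s ∈ F a ⊎ s ∈ F b → Inside s
      inside s∉Q s∈ = let s∈a , s∈b , _ = outer-either s∉Q s∈ in inj₂ (s∈a , s∈b)

      p∈b : p ∈ F b
      p∈b with fork near (inj₁ y∈Q) (inj₂ (inj₂ v∉Q)) (flip-adj p~y) (flip-adj v~y) (flip-adj v≁p)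
      ... | inj₁ (y∈a , _)     = contradiction y∈a y∉a
      ... | inj₂ (_ , p∈b , _) = p∈b

      touching : ∀ {z s} → z ∈ Q → s ∉ Q → z ~ s → Inside s
      touching z∈Q s∉Q z~s with joint near z∈Q s∉Q z~s
      ... | inj₁ (_ , s∈a) = inside s∉Q (inj₁ s∈a)
      ... | inj₂ (_ , s∈b) = inside s∉Q (inj₂ s∈b)

      spread : ∀ {z s} → Inside z → z ~ s → Inside s
      spread {z} {s} z∈ z~s with s ∈? Q | z ∈? Q | z∈
      ... | yes s∈Q | _       | _        = inj₁ s∈Q
      ... | no s∉Q  | yes z∈Q | _        = touching z∈Q s∉Q z~s
      ... | no _    | no z∉Q  | inj₁ z∈Q = contradiction z∈Q z∉Q
      ... | no s∉Q  | no z∉Q  | inj₂ (z∈a , z∈b) with proj₂ (outer B V z∉Q z∈a)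
      ...   | inj₁ Z   = inside s∉Q (inj₁ (proj₂ (roof-neighbour B Z s∉Q z~s)))
      -- Now the dent `p` ties `z` to `Q`: inside `b`, `v ~ z` and `v ≁ p` give `z ~ p`.
      ...   | inj₂ v~z with bool-cases (adj H s p)
      ...     | inj₁ s~p = touching p∈Q s∉Q (flip-adj s~p)
      ...     | inj₂ s≁p =
        [ (λ (_ , s∈a , _) → inside s∉Q (inj₁ s∈a)) , (λ (_ , s∈b , _) → inside s∉Q (inj₂ s∈b)) ]
          (fork near (inj₂ (inj₂ p∈Q)) (inj₁ z∉Q) z~s z~p s≁p)
        where
        z~p : z ~ p
        z~p = linkIn z∈b v∈b p∈b (flip-adj v~z) v≁p

      everywhere : ∀ u → Inside u
      everywhere u = reach-closed Inside spread (conn x u) (inj₁ x∈Q)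

  -- A triangle whose outer vertex sees all of `Q`.

  module FullRoof {a b x y v} (B : Base a b x y) (V : Roof a b x y v)
                  (full : ∀ {p} → p ∈ Q → v ~ p) (conn : Connected H) where
    open Base B
    open Roof V

    Q⊆a∪b : ∀ {p} → p ∈ Q → p ∈ F a ⊎ p ∈ F b
    Q⊆a∪b p∈Q with joint near p∈Q v∉Q (flip-adj (full p∈Q))
    ... | inj₁ (p∈a , _) = inj₁ p∈a
    ... | inj₂ (p∈b , _) = inj₂ p∈b

    -- The alternative `v ~ t` would close a triangle `v t r` inside `a` or `b`, because `v` sees
    -- `r`.
    rim : ∀ {t r} → t ∉ Q → r ∈ Q → t ~ r → Roof a b x y t
    rim {t} {r} t∉Q r∈Q t~r with joint near r∈Q t∉Q (flip-adj t~r)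
    ... | inj₁ (r∈a , t∈a) with outer-either B V t∉Q (inj₁ t∈a)
    ...   | _ , _ , inj₁ T   = T
    ...   | _ , _ , inj₂ v~t = clash t~r (linkIn t∈a v∈a r∈a (flip-adj v~t) (full r∈Q))
    rim {t} {r} t∉Q r∈Q t~r | inj₂ (r∈b , t∈b) with outer-either B V t∉Q (inj₂ t∈b)
    ...   | _ , _ , inj₁ T   = T
    ...   | _ , _ , inj₂ v~t = clash t~r (linkIn t∈b v∈b r∈b (flip-adj v~t) (full r∈Q))

    -- The side of `Q` that contains `y`, read off from `x`.
    OnY : Fin n → Set
    OnY s = s ∈ Q × x ~ s

    onY? : ∀ s → Dec (OnY s)
    onY? s = s ∈? Q ×-dec adj H x s ≟ᵇ true

    inQ²? : ∀ u s → Dec (u ∈ Q × s ∈ Q)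
    inQ²? u s = u ∈? Q ×-dec s ∈? Q

    apexAdj : Fin n → Bool
    apexAdj s = adj H v s ∧ not (does (onY? s))

    -- Delete the edges inside Q and add an apex (zero) with the neighbours of v
    -- outside the part of y.  The apex tells the biclique a, which it joins, from
    -- b, which becomes a ∪ b.
    H′ : Graph (suc n)
    H′ = record { adj = adj′ ; symm = symm′ ; irrefl = irrefl′ }
      where
      adj′ : Fin (suc n) → Fin (suc n) → Bool
      adj′ zero    zero    = false
      adj′ zero    (suc s) = apexAdj s
      adj′ (suc u) zero    = apexAdj u
      adj′ (suc u) (suc s) = adj H u s ∧ not (does (inQ²? u s))
      symm′ : ∀ u s → adj′ u s ≡ adj′ s u
      symm′ zero    zero    = refl
      symm′ zero    (suc s) = refl
      symm′ (suc u) zero    = refl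
      symm′ (suc u) (suc s) =
        cong₂ (λ α β → α ∧ not β) (symm H u s) (∧-comm (does (u ∈? Q)) (does (s ∈? Q)))
      irrefl′ : ∀ u → adj′ u u ≡ false
      irrefl′ zero    = refl
      irrefl′ (suc u) = cong (_∧ not (does (inQ²? u u))) (irrefl H u)

    unless-true : ∀ {A : Set} {c} (a? : Dec A) → A → c ∧ not (does a?) ≡ false
    unless-true {c = c} a? p = trans (cong (λ d → c ∧ not d) (dec-true a? p)) (∧-zeroʳ c)

    unless-false : ∀ {A : Set} {c} (a? : Dec A) → ¬ A → c ∧ not (does a?) ≡ c
    unless-false {c = c} a? ¬p = trans (cong (λ d → c ∧ not d) (dec-false a? ¬p)) (∧-identityʳ c)

    cut : ∀ {u s} → u ∈ Q → s ∈ Q → adj H′ (suc u) (suc s) ≡ false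
    cut u∈Q s∈Q = unless-true (inQ²? _ _) (u∈Q , s∈Q)

    kept : ∀ {u s} → ¬ (u ∈ Q × s ∈ Q) → adj H′ (suc u) (suc s) ≡ adj H u s
    kept = unless-false (inQ²? _ _)

    ρ : Fin (suc n) → Fin n
    ρ zero    = v
    ρ (suc u) = u

    Good : Fin (suc n) → Set
    Good s = ∀ {u} → s ≡ suc u → ¬ OnY u

    same-side : ∀ {u s} → u ∈ Q → s ∈ Q → x ≁ u → x ≁ s → u ≁ s
    same-side u∈Q s∈Q x≁u x≁s = linkIn u∈Q x∈Q s∈Q (flip-adj x≁u) x≁s

    -- Away from the side of `y` the apex is a copy of `v`, and no edge was cut: two such vertices
    -- of `Q` are on the same side.
    ρ-adj : ∀ {s t} → Good s → Good t → adj H′ s t ≡ adj H (ρ s) (ρ t)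
    ρ-adj {zero}  {zero}  _  _  = sym (irrefl H v)
    ρ-adj {zero}  {suc t} _  gt = unless-false (onY? t) (gt refl)
    ρ-adj {suc s} {zero}  gs _  = trans (unless-false (onY? s) (gs refl)) (symm H v s)
    ρ-adj {suc s} {suc t} gs gt = case inQ²? s t of λ where
        (no ¬Q²)          → kept ¬Q²
        (yes (s∈Q , t∈Q)) → trans (cut s∈Q t∈Q) (sym (same-side s∈Q t∈Q
          (¬~⇒≁ (λ e → gs refl (s∈Q , e))) (¬~⇒≁ (λ e → gt refl (t∈Q , e)))))
      where
      ¬~⇒≁ : ∀ {u w} → ¬ (u ~ w) → u ≁ w
      ¬~⇒≁ ¬e = ¬T⁻ (¬e ∘ T⁻)

    -- The apex accompanies `v` everywhere except in `b`. Were it in the enlarged `b` as well, that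
    -- set would contain the one for `a`.
    InF′ : Fin (suc m) → Fin (suc n) → Set
    InF′ i zero    = i ≢ b × v ∈ F i
    InF′ i (suc u) = u ∈ F i ⊎ (i ≡ b × u ∈ F a)

    inF′? : ∀ i s → Dec (InF′ i s)
    inF′? i zero    = ¬? (i ≟ b) ×-dec v ∈? F i
    inF′? i (suc u) = u ∈? F i ⊎-dec (i ≟ b ×-dec u ∈? F a)

    abstract
      F′ : Fin (suc m) → Subset (suc n)
      F′ i = select (inF′? i)

      intro : ∀ i {s} → InF′ i s → s ∈ F′ i
      intro i = ∈-select⁺ (inF′? i)

      elim : ∀ i {s} → s ∈ F′ i → InF′ i s
      elim i = ∈-select⁻ (inF′? i)

    elim-other : ∀ {i u} → i ≢ b → suc u ∈ F′ i → u ∈ F i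
    elim-other {i} i≢b u∈ with elim i u∈
    ... | inj₁ u∈i       = u∈i
    ... | inj₂ (i≡b , _) = contradiction i≡b i≢b

    elim-b : ∀ {u} → suc u ∈ F′ b → u ∈ F a ⊎ u ∈ F b
    elim-b u∈ = [ inj₂ , inj₁ ∘ proj₂ ] (elim b u∈)

    ρ∈ : ∀ {i s} → i ≢ b → s ∈ F′ i → ρ s ∈ F i
    ρ∈ {i} {zero}  _   s∈ = proj₂ (elim i s∈)
    ρ∈ {i} {suc u} i≢b s∈ = elim-other i≢b s∈

    -- A vertex of `a` on the side of `y` would form a triangle with `v` and `x`, as `v` sees all of
    -- `Q`.
    good : ∀ {i s} → i ≢ q → i ≢ b → s ∈ F′ i → Good s
    good i≢q i≢b s∈ refl (u∈Q , x~u) with locate u∈Q (elim-other i≢b s∈) i≢q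
    ... | inj₁ refl = clash (full u∈Q) (linkIn v∈a x∈a (elim-other i≢b s∈) v~x x~u)
    ... | inj₂ i≡b  = i≢b i≡b

    bipartite-other : ∀ {i} → i ≢ q → i ≢ b → CompleteBipartite H′ (F′ i)
    bipartite-other {i} i≢q i≢b = completeBipartite e λ u∈ v∈ w∈ →
        trans (ρ-adj (good i≢q i≢b u∈) (good i≢q i≢b w∈))
          (trans (cocycle (bipartite i) (ρ∈ i≢b u∈) (ρ∈ i≢b v∈) (ρ∈ i≢b w∈))
            (sym (cong₂ _xor_ (ρ-adj (good i≢q i≢b u∈) (good i≢q i≢b v∈))
                              (ρ-adj (good i≢q i≢b v∈) (good i≢q i≢b w∈)))))
      where
      e : ∃₂ λ s t → s ∈ F′ i × t ∈ F′ i × adj H′ s t ≡ true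
      e = let s , t , s∈ , t∈ , s~t = edge (bipartite i)
              s∈′ = intro i (inj₁ s∈)
              t∈′ = intro i (inj₁ t∈)
          in suc s , suc t , s∈′ , t∈′ ,
             trans (ρ-adj (good i≢q i≢b s∈′) (good i≢q i≢b t∈′)) s~t

    -- Adjacency to `v` gives the sides. `Q` falls on one side, where its edges have been cut; any
    -- other pair has a vertex outside `Q`, which lies in both `a` and `b`, so one of these holds
    -- the pair along with `v`.
    bipartite-b : CompleteBipartite H′ (F′ b)
    bipartite-b = fromSides (adj H v ∘ ρ)
      (suc v , suc x , intro b (inj₁ v∈b) , intro b (inj₂ (refl , x∈a)) ,
       trans (kept (v∉Q ∘ proj₁)) v~x)
      λ { {zero}  {_}     s∈ _  → contradiction refl (proj₁ (elim b s∈))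
        ; {suc _} {zero}  _  t∈ → contradiction refl (proj₁ (elim b t∈))
        ; {suc s} {suc t} s∈ t∈ → sides (elim-b s∈) (elim-b t∈) }
      where
      through : ∀ {i s t} → s ∈ F i → v ∈ F i → t ∈ F i → adj H s t ≡ adj H v s xor adj H v t
      through {s = s} s∈ v∈ t∈ = linkIn s∈ v∈ t∈ (symm H s v) refl
      both : ∀ {s t} → s ∈ F a ⊎ s ∈ F b → t ∈ F a × t ∈ F b → adj H s t ≡ adj H v s xor adj H v t
      both (inj₁ s∈a) (t∈a , _) = through s∈a v∈a t∈a
      both (inj₂ s∈b) (_ , t∈b) = through s∈b v∈b t∈b
      outer-both : ∀ {s} → s ∉ Q → s ∈ F a ⊎ s ∈ F b → s ∈ F a × s ∈ F b
      outer-both s∉Q s∈ = let s∈a , s∈b , _ = outer-either B V s∉Q s∈ in s∈a , s∈b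
      sides : ∀ {s t} → s ∈ F a ⊎ s ∈ F b → t ∈ F a ⊎ t ∈ F b →
              adj H′ (suc s) (suc t) ≡ adj H v s xor adj H v t
      sides {s} {t} s∈ t∈ = case (s ∈? Q) , (t ∈? Q) of λ where
        (yes s∈Q , yes t∈Q) → trans (cut s∈Q t∈Q) (sym (cong₂ _xor_ (full s∈Q) (full t∈Q)))
        (_ , no t∉Q) → trans (kept (t∉Q ∘ proj₂)) (both s∈ (outer-both t∉Q t∈))
        (no s∉Q , yes _) → trans (kept (s∉Q ∘ proj₁))
          (trans (flip-adj (both t∈ (outer-both s∉Q s∈))) (xor-comm (adj H v t) (adj H v s)))

    bipartite′ : ∀ {i} → i ≢ q → CompleteBipartite H′ (F′ i)
    bipartite′ {i} i≢q = case i ≟ b of λ where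
      (yes refl) → bipartite-b
      (no i≢b)   → bipartite-other i≢q i≢b

    antichain′ : ∀ {i j} → i ≢ q → j ≢ q → F′ i ⊆ F′ j → i ≡ j
    antichain′ {i} {j} i≢q _ i⊆j with i ≟ b | j ≟ b
    ... | _        | no j≢b = antichain λ u∈ → elim-other j≢b (i⊆j (intro i (inj₁ u∈)))
    ... | yes i≡b  | yes j≡b = trans i≡b (sym j≡b)
    -- `F′ b` lacks the apex, so `v` is not in `F i`. But `F i` lies in `F a`, since `a` and `b`
    -- agree outside `Q`, and so `i` would be `a`, which contains `v`.
    ... | no i≢b   | yes refl = contradiction (subst (λ k → v ∈ F k) (sym i≡a) v∈a) v∉i
      where
      v∉i : v ∉ F i
      v∉i v∈i = proj₁ (elim b {zero} (i⊆j (intro i (i≢b , v∈i)))) refl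
      i⊆a : F i ⊆ F a
      i⊆a {u} u∈ with u ∈? Q
      ... | no u∉Q = proj₁ (outer-either B V u∉Q (elim-b (i⊆j (intro i (inj₁ u∈)))))
      ... | yes u∈Q with locate u∈Q u∈ i≢q
      ...   | inj₁ refl = u∈
      ...   | inj₂ i≡b  = contradiction i≡b i≢b
      i≡a : i ≡ a
      i≡a = antichain i⊆a

    -- A vertex of `b` on the side of `x` in `Q` would form a triangle with `v` and `y`; outside `Q`
    -- the two bicliques agree.
    b⊆a-off-Y : ∀ {u} → u ∈ F b → ¬ OnY u → u ∈ F a
    b⊆a-off-Y {u} u∈b ¬onY with u ∈? Q
    ... | no u∉Q = proj₁ (outer-either B V u∉Q (inj₂ u∈b))
    ... | yes u∈Q with Q⊆a∪b u∈Q
    ...   | inj₁ u∈a = u∈a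
    ...   | inj₂ _ with bool-cases (adj H x u)
    ...     | inj₁ x~u = contradiction (u∈Q , x~u) ¬onY
    ...     | inj₂ x≁u = clash (full u∈Q) (linkIn v∈b y∈b u∈b v~y
                           (linkIn y∈Q x∈Q u∈Q (flip-adj x~y) x≁u))

    covers′ : ∀ {S} → CompleteBipartite H′ S → ∃ λ i → i ≢ q × S ⊆ F′ i
    covers′ {S} cb with any? (λ r → suc r ∈? S ×-dec onY? r)
    -- Neither `Q` nor the apex has edges to `r` in `H′`, so a neighbour `t` of `r` in `S` is an
    -- outer vertex and a roof. Then `S` lies in the union of `a` and `b`.
    ... | yes (r , r∈S , r∈Q , x~r) with neighbour cb r∈S
    ...   | zero  , _   , r~t =
      clash r~t (unless-true {c = adj H v r} (onY? r) (r∈Q , x~r))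
    ...   | suc t , t∈S , r~t = b , b≢q , λ s∈ → intro b (in-b s∈)
      where
      t∉Q : t ∉ Q
      t∉Q t∈Q = clash r~t (cut r∈Q t∈Q)
      t-roof : Roof a b x y t
      t-roof = rim t∉Q r∈Q (flip-adj (trans (sym (kept (t∉Q ∘ proj₂))) r~t))
      outer-in-b : ∀ {u} → u ∉ Q → suc u ∈ S →
        adj H′ (suc u) (suc r) ≡ true ⊎ adj H′ (suc u) (suc r) ≡ false → InF′ b (suc u)
      outer-in-b u∉Q _  (inj₁ u~r) =
        inj₁ (Roof.v∈b (rim u∉Q r∈Q (trans (sym (kept (u∉Q ∘ proj₁))) u~r)))
      outer-in-b u∉Q u∈ (inj₂ u≁r) = inj₂ (refl , proj₂ (roof-neighbour B t-roof u∉Q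
        (flip-adj (trans (sym (kept (u∉Q ∘ proj₁))) (link cb u∈ r∈S t∈S u≁r r~t)))))
      in-b : ∀ {s} → s ∈ S → InF′ b s
      in-b {suc u} s∈ = case u ∈? Q of λ where
        (yes u∈Q) → [ (λ u∈a → inj₂ (refl , u∈a)) , inj₁ ] (Q⊆a∪b u∈Q)
        (no u∉Q)  → outer-in-b u∉Q s∈ (bool-cases _)
      in-b {zero} s∈ = clash (Roof.v~x t-roof) (proj₁ (roof-neighbour B V t∉Q v~t))
        where
        v~t : v ~ t
        v~t = trans (sym (unless-false (onY? t) (t∉Q ∘ proj₁)))
                (link cb s∈ r∈S t∈S (unless-true {c = adj H v r} (onY? r) (r∈Q , x~r)) r~t)
    -- `S` avoids the side of `y`, so it maps faithfully to `H`. There `b` can be replaced by `a`,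
    -- and `q` is impossible because no edge inside `Q` remains.
    covers′ {S} cb | no noY = choose
        (image-covered {H′ = H′} ρ (λ s∈ t∈ → ρ-adj (goodS s∈) (goodS t∈)) cb)
      where
      goodS : ∀ {s} → s ∈ S → Good s
      goodS s∈ refl onY = noY (_ , s∈ , onY)
      choose : (∃ λ i → ∀ {s} → s ∈ S → ρ s ∈ F i) → ∃ λ i → i ≢ q × S ⊆ F′ i
      choose (i , S⊆) with i ≟ q | i ≟ b
      ... | no i≢q | no i≢b = i , i≢q , λ
        { {zero}  s∈ → intro i (i≢b , S⊆ s∈)
        ; {suc u} s∈ → intro i (inj₁ (S⊆ s∈)) }
      ... | no _ | yes refl = a , a≢q , λ
        { {zero}  _  → intro a (a≢b , v∈a)
        ; {suc u} s∈ → intro a (inj₁ (b⊆a-off-Y (S⊆ s∈) (goodS s∈ refl))) }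
      ... | yes refl | _ with edge cb
      ...   | zero  , _     , s∈ , _  , _   = contradiction (S⊆ s∈) v∉Q
      ...   | suc _ , zero  , _  , t∈ , _   = contradiction (S⊆ t∈) v∉Q
      ...   | suc s , suc t , s∈ , t∈ , s~t = clash s~t (cut (S⊆ s∈) (S⊆ t∈))

    meet⁺ : ∀ {i j} → i ≢ q → j ≢ q → i ≢ j → Meet (F i) (F j) → Meet (F′ i) (F′ j)
    meet⁺ {i} {j} _ _ _ (u , u∈i , u∈j) = suc u , intro i (inj₁ u∈i) , intro j (inj₁ u∈j)

    -- Enlarging `b` by `a` creates no new intersection: outside `Q` a vertex of `a` is already in
    -- `b`, and inside `Q` only `a` itself can contain it, which meets `b` in `v`.
    meet-b : ∀ {j u} → j ≢ q → j ≢ b → u ∈ F a → u ∈ F j → Meet (F b) (F j)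
    meet-b {u = u} j≢q j≢b u∈a u∈j with u ∈? Q
    ... | no u∉Q = u , proj₁ (proj₂ (outer-either B V u∉Q (inj₁ u∈a))) , u∈j
    ... | yes u∈Q with locate u∈Q u∈j j≢q
    ...   | inj₁ refl = v , v∈b , v∈a
    ...   | inj₂ j≡b  = contradiction j≡b j≢b

    meet⁻ : ∀ {i j} → i ≢ q → j ≢ q → i ≢ j → Meet (F′ i) (F′ j) → Meet (F i) (F j)
    meet⁻ {i} {j} _ _ _ (zero , s∈i , s∈j) = v , proj₂ (elim i s∈i) , proj₂ (elim j s∈j)
    meet⁻ {i} {j} i≢q j≢q i≢j (suc u , s∈i , s∈j) with elim i s∈i | elim j s∈j
    ... | inj₁ u∈i          | inj₁ u∈j          = u , u∈i , u∈j
    ... | inj₁ u∈i          | inj₂ (refl , u∈a) = meet-sym (meet-b i≢q i≢j u∈a u∈i)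
    ... | inj₂ (refl , u∈a) | inj₁ u∈j          = meet-b j≢q (i≢j ∘ sym) u∈a u∈j
    ... | inj₂ (i≡b , _)    | inj₂ (j≡b , _)    = contradiction (trans i≡b (sym j≡b)) i≢j

    H′-connected : Connected H′
    H′-connected s t = reach-trans (toX s) (reach-sym H′ (toX t))
      where
      lift : ∀ {u w} → Reach H u w → Reach H′ (suc u) (suc w)
      lift here = here
      lift (step {u} {w} e r) with inQ²? u w
      ... | no ¬Q²            = step (T⁺ (trans (kept ¬Q²) (T⁻ e))) (lift r)
      -- A cut edge is bypassed through `v`.
      ... | yes (u∈Q , w∈Q) = step {v = suc v}
        (T⁺ (trans (kept (v∉Q ∘ proj₂)) (flip-adj (full u∈Q))))
        (step (T⁺ (trans (kept (v∉Q ∘ proj₁)) (full w∈Q))) (lift r))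
      toX : ∀ s → Reach H′ s (suc x)
      toX (suc u) = lift (conn u x)
      toX zero    = step (T⁺ (trans (unless-false (onY? x) x∉Y) v~x)) here
        where
        x∉Y : ¬ OnY x
        x∉Y (_ , x~x) = clash x~x (irrefl H x)

    isBicliqueGraph : IsBicliqueGraph (delete G q)
    isBicliqueGraph =
      deletion-isBicliqueGraph H′ H′-connected F′ bipartite′ antichain′ covers′ meet⁺ meet⁻

  -- No triangle over an edge of Q

  NoRoof : Set
  NoRoof = ∀ {v x y} → v ∉ Q → x ∈ Q → y ∈ Q → x ~ y → v ~ x → v ≁ y

  -- Vertices outside Q attach to both sides of Q.
  record Opposite (a b : Fin (suc m)) (x′ y′ x y : Fin n) : Set where
    field
      near  : Near a b
      x′∈Q  : x′ ∈ Q
      y′∈Q  : y′ ∈ Q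
      y∈Q   : y ∈ Q
      x∈Q   : x ∈ Q
      x′~y′ : x′ ~ y′
      x~y′  : x ~ y′
      y~x′  : y ~ x′
      x∈a   : x ∈ F a
      y′∈a  : y′ ∈ F a
      x′∉a  : x′ ∉ F a
      y∈b   : y ∈ F b
      x′∈b  : x′ ∈ F b
      y′∉b  : y′ ∉ F b

  opposite-sym : ∀ {a b x′ y′ x y} → Opposite a b x′ y′ x y → Opposite b a y′ x′ y x
  opposite-sym O = record
    { near = near-sym near ; x′∈Q = y′∈Q ; y′∈Q = x′∈Q ; y∈Q = x∈Q ; x∈Q = y∈Q
    ; x′~y′ = flip-adj x′~y′ ; x~y′ = y~x′ ; y~x′ = x~y′
    ; x∈a = y∈b ; y′∈a = x′∈b ; x′∉a = y′∉b ; y∈b = x∈a ; x′∈b = y′∈a ; y′∉b = x′∉a }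
    where open Opposite O

  module _ (noRoof : NoRoof) where

    -- The cherry at `z` with leaves `s` and `y′` must lie in `a`, as `y′` is not in `b`. If `s`
    -- were in `b`, missing `y` would force it to see `x′`; but then the cherry at `x′` with leaves
    -- `s` and `y′` fits neither biclique.
    attached : ∀ {a b x′ y′ x y} → Opposite a b x′ y′ x y → ∀ {s z} →
      s ∉ Q → z ∈ Q → z ~ y′ → s ~ z → s ∈ F a × z ∈ F a × s ∉ F b
    attached {b = b} {x′} {y′} {x} {y} O {s} {z} s∉Q z∈Q z~y′ s~z
      with fork near (inj₁ z∈Q) (inj₂ (inj₁ s∉Q)) (flip-adj s~z) z~y′ s≁y′
      where
      open Opposite O
      s≁y′ : s ≁ y′
      s≁y′ = noRoof s∉Q z∈Q y′∈Q z~y′ s~z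
    ... | inj₂ (_ , _ , y′∈b)  = contradiction y′∈b (Opposite.y′∉b O)
    ... | inj₁ (z∈a , s∈a , _) = s∈a , z∈a , s∉b (bool-cases (adj H s x′))
      where
      open Opposite O
      z~y : z ~ y
      z~y = linkIn z∈Q x′∈Q y∈Q (linkIn z∈Q y′∈Q x′∈Q z~y′ (flip-adj x′~y′)) (flip-adj y~x′)
      s≁y : s ≁ y
      s≁y = noRoof s∉Q z∈Q y∈Q z~y s~z
      s∉b : s ~ x′ ⊎ s ≁ x′ → s ∉ F b
      s∉b (inj₂ s≁x′) s∈b = clash (linkIn s∈b y∈b x′∈b s≁y y~x′) s≁x′
      s∉b (inj₁ s~x′) _
        with fork near (inj₁ x′∈Q) (inj₂ (inj₁ s∉Q)) (flip-adj s~x′) x′~y′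
               (noRoof s∉Q z∈Q y′∈Q z~y′ s~z)
      ... | inj₁ (x′∈a , _)      = x′∉a x′∈a
      ... | inj₂ (_ , _ , y′∈b) = y′∉b y′∈b

    -- If `t` sees `z`, the triangle `s t z` lies in `a`. Otherwise `t` is in `a` and parity
    -- attaches it to `y′`, on the other side, where attached vertices are not in `a`.
    opposite-free : ∀ {a b x′ y′ x y} → Opposite a b x′ y′ x y → ∀ {z s t} →
      z ∈ Q → z ~ y′ → s ~ z → s ∉ Q → t ∉ Q → s ~ t → ⊥
    opposite-free {a} {y′ = y′} O {z} {s} {t} z∈Q z~y′ s~z s∉Q t∉Q s~t
      with attached O s∉Q z∈Q z~y′ s~z | bool-cases (adj H t z)
    ... | s∈a , z∈a , s∉b | inj₁ t~z =
      clash s~z (linkIn s∈a (proj₁ (attached O t∉Q z∈Q z~y′ t~z)) z∈a s~t t~z)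
    ... | s∈a , z∈a , s∉b | inj₂ t≁z
      with fork (Opposite.near O) (inj₂ (inj₁ z∈Q)) (inj₁ s∉Q) s~z s~t (flip-adj t≁z)
    ...   | inj₂ (s∈b , _)       = s∉b s∈b
    ...   | inj₁ (_ , _ , t∈a) =
      proj₂ (proj₂ (attached (opposite-sym O) t∉Q y′∈Q (flip-adj x′~y′) t~y′)) t∈a
      where
      open Opposite O
      t~y′ : t ~ y′
      t~y′ = linkIn t∈a z∈a y′∈a t≁z z~y′

    opposite : ∀ {a b x′ y′ x y} → Connected H → Opposite a b x′ y′ x y → Meet (F a) (F b) →
      IsBicliqueGraph (delete G q)
    opposite {y′ = y′} conn O common = no-outer-edge conn near common free
      where
      open Opposite O
      free : ∀ {z s t} → z ∈ Q → s ~ z → s ∉ Q → t ∉ Q → s ~ t → ⊥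
      free {z} z∈Q s~z with bool-cases (adj H z y′)
      ... | inj₁ z~y′ = opposite-free O z∈Q z~y′ s~z
      ... | inj₂ z≁y′ = opposite-free (opposite-sym O) z∈Q
                          (linkIn z∈Q y′∈Q x′∈Q z≁y′ (flip-adj x′~y′)) s~z

    -- If `v` saw the whole side of `x`, then `Q` together with `v` would be complete bipartite,
    -- against maximality of `Q`.
    indent : ∀ {v x y} → v ∉ Q → x ∈ Q → v ~ x → y ∈ Q → x ~ y →
      ∃ λ x′ → x′ ∈ Q × x′ ~ y × v ≁ x′
    indent {v} {x} {y} v∉Q x∈Q v~x y∈Q x~y
      with any? (λ p → p ∈? Q ×-dec adj H p y ≟ᵇ true ×-dec adj H v p ≟ᵇ false)
    ... | yes p  = p
    ... | no none =
      let i , i≢q , Q⊆i = attach (_∈? Q) (λ u∈ → u∈) y∈Q v∉Q like-y x∈Q x~y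
                            (noRoof v∉Q x∈Q y∈Q x~y v~x)
      in contradiction (sym (antichain Q⊆i)) i≢q
      where
      like-y : ∀ {u} → u ∈ Q → adj H v u ≡ adj H u y
      like-y {u} u∈Q with bool-cases (adj H u y) | bool-cases (adj H v u)
      ... | inj₁ u~y | inj₁ v~u = trans v~u (sym u~y)
      ... | inj₁ u~y | inj₂ v≁u = contradiction (u , u∈Q , u~y , v≁u) none
      ... | inj₂ u≁y | _        = trans (noRoof v∉Q x∈Q u∈Q
        (flip-adj (linkIn u∈Q y∈Q x∈Q u≁y (flip-adj x~y))) v~x) (sym u≁y)

  -- Outer neighbours on one side of `Q` only.

  OneSided : Fin n → Set
  OneSided y = ∀ {u r} → u ∉ Q → r ∈ Q → r ≁ y → u ≁ r

  record Distinguished (a b : Fin (suc m)) (y p : Fin n) : Set where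
    field
      near : Near a b
      y∈Q  : y ∈ Q
      y∈a  : y ∈ F a
      y∈b  : y ∈ F b
      p∈Q  : p ∈ Q
      p~y  : p ~ y
      p∈a  : p ∈ F a
      p∉b  : p ∉ F b

  -- Outer vertices miss `y`, which is in both `a` and `b`, while `p` pins cherries to `a`. An edge
  -- between outer vertices near `Q` then yields a triangle in one biclique or an edge to `y`.
  distinguished : ∀ {a b y p} → Connected H → OneSided y → Distinguished a b y p →
    IsBicliqueGraph (delete G q)
  distinguished {a} {b} {y} {p} conn oneSided D = no-outer-edge conn near (y , y∈a , y∈b) free
    where
    open Distinguished D
    off-y : ∀ {u} → u ∉ Q → u ≁ y
    off-y u∉Q = oneSided u∉Q y∈Q (irrefl H y)

    cross : ∀ {s t} → s ∈ F a → s ∉ Q → t ∉ Q → s ~ t → ⊥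
    cross {s} {t} s∈a s∉Q t∉Q s~t with bool-cases (adj H t p)
    ... | inj₁ t~p with fork near (inj₁ p∈Q) (inj₂ (inj₁ t∉Q)) (flip-adj t~p) p~y (off-y t∉Q)
    ...   | inj₁ (_ , t∈a , _) = clash (linkIn s∈a y∈a p∈a (off-y s∉Q) (flip-adj p~y))
                                        (linkIn s∈a t∈a p∈a s~t t~p)
    ...   | inj₂ (p∈b , _)     = p∉b p∈b
    cross {s} {t} s∈a s∉Q t∉Q s~t | inj₂ t≁p
      with fork near (inj₂ (inj₂ p∈Q)) (inj₁ s∉Q) s~t
             (linkIn s∈a y∈a p∈a (off-y s∉Q) (flip-adj p~y)) t≁p
    ...   | inj₁ (_ , t∈a , _) = clash (linkIn t∈a p∈a y∈a t≁p p~y) (off-y t∉Q)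
    ...   | inj₂ (_ , _ , p∈b) = p∉b p∈b

    free : ∀ {z s t} → z ∈ Q → s ~ z → s ∉ Q → t ∉ Q → s ~ t → ⊥
    free {z} {s} {t} z∈Q s~z s∉Q t∉Q s~t with bool-cases (adj H z y)
    ... | inj₂ z≁y = clash s~z (oneSided s∉Q z∈Q z≁y)
    ... | inj₁ z~y with bool-cases (adj H t z)
    ...   | inj₂ t≁z with fork near (inj₂ (inj₁ z∈Q)) (inj₁ s∉Q) s~z s~t (flip-adj t≁z)
    ...     | inj₁ (_ , z∈a , t∈a) = clash (linkIn t∈a z∈a y∈a t≁z z~y) (off-y t∉Q)
    ...     | inj₂ (_ , z∈b , t∈b) = clash (linkIn t∈b z∈b y∈b t≁z z~y) (off-y t∉Q)
    free {z} {s} {t} z∈Q s~z s∉Q t∉Q s~t | inj₁ z~y | inj₁ t~z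
      with fork near (inj₁ z∈Q) (inj₂ (inj₁ s∉Q)) (flip-adj s~z) z~y (off-y s∉Q)
         | fork near (inj₁ z∈Q) (inj₂ (inj₁ t∉Q)) (flip-adj t~z) z~y (off-y t∉Q)
    ...     | inj₁ (_ , s∈a , _)   | _                  = cross s∈a s∉Q t∉Q s~t
    ...     | inj₂ _               | inj₁ (_ , t∈a , _) = cross t∈a t∉Q s∉Q (flip-adj s~t)
    ...     | inj₂ (z∈b , s∈b , _) | inj₂ (_ , t∈b , _) = clash s~z (linkIn s∈b t∈b z∈b s~t t~z)

  Uniform : Fin n → Set
  Uniform v = ∀ {w z p} → w ∉ Q → z ∈ Q → w ~ z → p ∈ Q → adj H w p ≡ adj H v p

  -- Vertices on the side of `x` that `v` misses are missed by all outer vertices, so `q` is the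
  -- only biclique containing them. They fold onto `x`; what is left of `Q` fits with `v` into
  -- another biclique.
  uniform : ∀ {v x y} → Connected H → v ∉ Q → x ∈ Q → v ~ x → y ∈ Q → x ~ y →
    OneSided y → Uniform v → IsBicliqueGraph (delete G q)
  uniform {v} {x} {y} conn v∉Q x∈Q v~x y∈Q x~y oneSided uni =
    folding π (λ u → idem u (folded? u)) (λ {u} {w} → hom (folded? u) (folded? w)) conn fixed
      (let i , i≢q , ⊆i = attach rest? proj₁ y∈Q v∉Q (λ {u} → like-y {u}) x-rest x~y v≁y
       in i , i≢q , λ u∈Q πu≡u → ⊆i (u∈Q , fixed⇒¬folded πu≡u))
    where
    Folded : Fin n → Set
    Folded u = u ∈ Q × u ~ y × v ≁ u
    folded? : ∀ u → Dec (Folded u)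
    folded? u = u ∈? Q ×-dec adj H u y ≟ᵇ true ×-dec adj H v u ≟ᵇ false
    π : Fin n → Fin n
    π u = if does (folded? u) then x else u
    π-yes : ∀ {u} → Folded u → π u ≡ x
    π-yes {u} f = cong (λ c → if c then x else u) (dec-true (folded? u) f)
    π-no : ∀ {u} → ¬ Folded u → π u ≡ u
    π-no {u} ¬f = cong (λ c → if c then x else u) (dec-false (folded? u) ¬f)
    ¬folded-x : ¬ Folded x
    ¬folded-x (_ , _ , v≁x) = clash v~x v≁x
    fixed⇒¬folded : ∀ {u} → π u ≡ u → ¬ Folded u
    fixed⇒¬folded πu≡u f = ¬folded-x (subst Folded (trans (sym πu≡u) (π-yes f)) f)
    idem : ∀ u → Dec (Folded u) → π (π u) ≡ π u
    idem u (yes f) = trans (cong π (π-yes f)) (trans (π-no ¬folded-x) (sym (π-yes f)))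
    idem u (no ¬f) = cong π (π-no ¬f)

    v≁y : v ≁ y
    v≁y = oneSided v∉Q y∈Q (irrefl H y)

    retract : ∀ {u w} → Folded u → u ~ w → x ~ w
    retract {u} {w} (u∈Q , u~y , v≁u) u~w with w ∈? Q
    ... | no w∉Q  = clash (flip-adj u~w) (trans (uni w∉Q u∈Q (flip-adj u~w) u∈Q) v≁u)
    ... | yes w∈Q = linkIn x∈Q u∈Q w∈Q (linkIn x∈Q y∈Q u∈Q x~y (flip-adj u~y)) u~w
    hom : ∀ {u w} → Dec (Folded u) → Dec (Folded w) → u ~ w → π u ~ π w
    hom (no ¬f) (no ¬g) u~w =
      trans (cong₂ (adj H) (π-no ¬f) (π-no ¬g)) u~w
    hom (yes f) (no ¬g) u~w =
      trans (cong₂ (adj H) (π-yes f) (π-no ¬g)) (retract f u~w)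
    hom (no ¬f) (yes g) u~w =
      trans (cong₂ (adj H) (π-no ¬f) (π-yes g)) (flip-adj (retract g (flip-adj u~w)))
    hom (yes (u∈Q , u~y , _)) (yes (w∈Q , w~y , _)) u~w =
      clash u~w (linkIn u∈Q y∈Q w∈Q u~y (flip-adj w~y))

    -- All neighbours of `u` are in `Q`, on the side of `y`. An outer vertex of `F i` would miss
    -- such a neighbour and hence see `u`, so `F i` is contained in `Q`.
    folded∉ : ∀ {i u} → i ≢ q → u ∈ F i → ¬ Folded u
    folded∉ {i} {u} i≢q u∈i (u∈Q , u~y , v≁u) = i≢q (antichain i⊆Q)
      where
      outside≁u : ∀ {w} → w ∉ Q → w ≁ u
      outside≁u {w} w∉Q with bool-cases (adj H w u)
      ... | inj₁ w~u = trans (uni w∉Q u∈Q w~u u∈Q) v≁u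
      ... | inj₂ w≁u = w≁u
      i⊆Q : F i ⊆ Q
      i⊆Q {s} s∈i with s ∈? Q | neighbour (bipartite i) u∈i
      ... | yes s∈Q | _ = s∈Q
      ... | no s∉Q  | z , z∈i , u~z with z ∈? Q
      ...   | no z∉Q  = clash (flip-adj u~z) (outside≁u z∉Q)
      ...   | yes z∈Q = clash
        (linkIn s∈i z∈i u∈i
          (oneSided s∉Q z∈Q (linkIn z∈Q u∈Q y∈Q (flip-adj u~z) u~y)) (flip-adj u~z))
        (outside≁u s∉Q)
    fixed : ∀ {i u} → i ≢ q → u ∈ F i → π u ≡ u
    fixed i≢q u∈ = π-no (folded∉ i≢q u∈)

    rest? : ∀ u → Dec (u ∈ Q × ¬ Folded u)
    rest? u = u ∈? Q ×-dec ¬? (folded? u)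
    x-rest : x ∈ Q × ¬ Folded x
    x-rest = x∈Q , ¬folded-x
    like-y : ∀ {u} → u ∈ Q × ¬ Folded u → adj H v u ≡ adj H u y
    like-y {u} (u∈Q , ¬f) with bool-cases (adj H u y) | bool-cases (adj H v u)
    ... | inj₁ u~y | inj₁ v~u = trans v~u (sym u~y)
    ... | inj₁ u~y | inj₂ v≁u = contradiction (u∈Q , u~y , v≁u) ¬f
    ... | inj₂ u≁y | _        = trans (oneSided v∉Q u∈Q u≁y) (sym u≁y)

  -- Case distinction for a vertex of degree two.

  module _ (conn : Connected H)
           (two : ∀ {i j k} → i ≢ j → adj G q i ≡ true → adj G q j ≡ true → adj G q k ≡ true →
                  k ≡ i ⊎ k ≡ j) where

    -- Each case may choose its own `a` and `b`: any two distinct bicliques that contain vertices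
    -- both in and outside `Q` exhaust the neighbours of `q`.
    near-of : ∀ {i j u w s t} → u ∈ F i → u ∈ Q → w ∈ F i → w ∉ Q →
              s ∈ F j → s ∈ Q → t ∈ F j → t ∉ Q → i ≢ j → Near i j
    near-of u∈i u∈Q w∈i w∉Q s∈j s∈Q t∈j t∉Q i≢j = record
      { a≢q = away w∉Q w∈i ; b≢q = away t∉Q t∈j ; a≢b = i≢j
      ; locate = λ r∈Q r∈k k≢q → two i≢j
          (meet⇒adj (away w∉Q w∈i ∘ sym) (_ , u∈Q , u∈i))
          (meet⇒adj (away t∉Q t∈j ∘ sym) (_ , s∈Q , s∈j))
          (meet⇒adj (k≢q ∘ sym) (_ , r∈Q , r∈k)) }

    separated : ∀ {i j u} → u ∈ F i → u ∉ F j → i ≢ j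
    separated u∈i u∉j refl = u∉j u∈i

    triangle-case : ∀ {v x y} → v ∉ Q → x ∈ Q → y ∈ Q → x ~ y → v ~ x → v ~ y →
      IsBicliqueGraph (delete G q)
    triangle-case {v} {x} {y} v∉Q x∈Q y∈Q x~y v~x v~y
      with cherry v~x v~x (irrefl H x) | cherry v~y v~y (irrefl H y)
    ... | a , v∈a , x∈a , _ | b , v∈b , y∈b , _ = conclude
      where
      y∉a : y ∉ F a
      y∉a y∈a = clash v~y (linkIn v∈a x∈a y∈a v~x x~y)
      x∉b : x ∉ F b
      x∉b x∈b = clash v~x (linkIn v∈b y∈b x∈b v~y (flip-adj x~y))
      B : Base a b x y
      B = record
        { near = near-of x∈a x∈Q v∈a v∉Q y∈b y∈Q v∈b v∉Q (separated x∈a x∉b)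
        ; x∈Q = x∈Q ; y∈Q = y∈Q ; x~y = x~y
        ; x∈a = x∈a ; y∈b = y∈b ; x∉b = x∉b ; y∉a = y∉a }
      V : Roof a b x y v
      V = record { v∉Q = v∉Q ; v~x = v~x ; v~y = v~y ; v∈a = v∈a ; v∈b = v∈b }
      conclude : IsBicliqueGraph (delete G q)
      conclude with any? (λ p → p ∈? Q ×-dec adj H v p ≟ᵇ false)
      ... | no none = FullRoof.isBicliqueGraph B V full conn
        where
        full : ∀ {p} → p ∈ Q → v ~ p
        full {p} p∈Q with bool-cases (adj H v p)
        ... | inj₁ v~p = v~p
        ... | inj₂ v≁p = contradiction (p , p∈Q , v≁p) none
      ... | yes (p , p∈Q , v≁p) with bool-cases (adj H p y)
      ...   | inj₁ p~y = dented B V conn p∈Q p~y v≁p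
      -- Here `p` is on the side of `y`, so the two ends of the base swap roles.
      ...   | inj₂ p≁y = dented (base-sym B) (roof-sym V) conn p∈Q
                           (linkIn p∈Q y∈Q x∈Q p≁y (flip-adj x~y)) v≁p

    -- Both traces are proper, so `v` misses some `x′` and `w` some `y′`. The cherries `v x y` and
    -- `w y x′` give bicliques `a` and `b` that share `y`, and the missed vertices tell them apart.
    two-sided-case : NoRoof → ∀ {v x w y} → v ∉ Q → x ∈ Q → v ~ x →
      w ∉ Q → y ∈ Q → w ~ y → x ~ y → IsBicliqueGraph (delete G q)
    two-sided-case noRoof {v} {x} {w} {y} v∉Q x∈Q v~x w∉Q y∈Q w~y x~y
      with indent noRoof v∉Q x∈Q v~x y∈Q x~y
         | indent noRoof w∉Q y∈Q w~y x∈Q (flip-adj x~y)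
    ... | x′ , x′∈Q , x′~y , v≁x′ | y′ , y′∈Q , y′~x , w≁y′
      with cherry (flip-adj v~x) x~y (noRoof v∉Q x∈Q y∈Q x~y v~x)
         | cherry (flip-adj w~y) (flip-adj x′~y) (noRoof w∉Q y∈Q x′∈Q (flip-adj x′~y) w~y)
    ...   | a , x∈a , v∈a , y∈a | b , y∈b , w∈b , x′∈b =
      opposite noRoof conn record
        { near = near ; x′∈Q = x′∈Q ; y′∈Q = y′∈Q ; y∈Q = y∈Q ; x∈Q = x∈Q
        ; x′~y′ = x′~y′ ; x~y′ = flip-adj y′~x ; y~x′ = flip-adj x′~y
        ; x∈a = x∈a ; y′∈a = y′∈a ; x′∉a = x′∉a ; y∈b = y∈b ; x′∈b = x′∈b ; y′∉b = y′∉b }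
        (y , y∈a , y∈b)
      where
      v≁y : v ≁ y
      v≁y = noRoof v∉Q x∈Q y∈Q x~y v~x
      v≁y′ : v ≁ y′
      v≁y′ = noRoof v∉Q x∈Q y′∈Q (flip-adj y′~x) v~x
      w≁x′ : w ≁ x′
      w≁x′ = noRoof w∉Q y∈Q x′∈Q (flip-adj x′~y) w~y
      x′~y′ : x′ ~ y′
      x′~y′ = linkIn x′∈Q x∈Q y′∈Q (linkIn x′∈Q y∈Q x∈Q x′~y (flip-adj x~y)) (flip-adj y′~x)
      x′∉a : x′ ∉ F a
      x′∉a x′∈a = clash (linkIn x′∈a y∈a v∈a x′~y (flip-adj v≁y)) (flip-adj v≁x′)
      y′∉b : y′ ∉ F b
      y′∉b y′∈b = clash (linkIn y′∈b x′∈b w∈b (flip-adj x′~y′) (flip-adj w≁x′)) (flip-adj w≁y′)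
      v∉b : v ∉ F b
      v∉b v∈b = clash (linkIn v∈b y∈b x′∈b v≁y (flip-adj x′~y)) v≁x′
      near : Near a b
      near = near-of x∈a x∈Q v∈a v∉Q y∈b y∈Q w∈b w∉Q (separated x′∈b x′∉a ∘ sym)
      y′∈a : y′ ∈ F a
      y′∈a with fork near (inj₁ x∈Q) (inj₂ (inj₁ v∉Q)) (flip-adj v~x) (flip-adj y′~x) v≁y′
      ... | inj₁ (_ , _ , y′∈a) = y′∈a
      ... | inj₂ (_ , v∈b , _)  = contradiction v∈b v∉b

    distinguished-case : ∀ {v w y p z} → OneSided y → y ∈ Q → v ∉ Q → p ∈ Q → v ~ p →
      w ∉ Q → w ≁ p → z ∈ Q → w ~ z → IsBicliqueGraph (delete G q)
    distinguished-case {v} {w} {y} {p} {z} oneSided y∈Q v∉Q p∈Q v~p w∉Q w≁p z∈Q w~z =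
      conclude (cherry (flip-adj v~p) (~y p∈Q v∉Q v~p) (off-y v∉Q))
               (cherry (flip-adj w~z) (~y z∈Q w∉Q w~z) (off-y w∉Q))
      where
      off-y : ∀ {u} → u ∉ Q → u ≁ y
      off-y u∉Q = oneSided u∉Q y∈Q (irrefl H y)
      ~y : ∀ {r u} → r ∈ Q → u ∉ Q → u ~ r → r ~ y
      ~y {r} r∈Q u∉Q u~r with bool-cases (adj H r y)
      ... | inj₁ r~y = r~y
      ... | inj₂ r≁y = clash u~r (oneSided u∉Q r∈Q r≁y)
      conclude : (∃ λ i → All (_∈ F i) p v y) → (∃ λ j → All (_∈ F j) z w y) →
                 IsBicliqueGraph (delete G q)
      conclude (a , p∈a , v∈a , y∈a) (b , z∈b , w∈b , y∈b) = distinguished conn oneSided record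
        { near = near-of p∈a p∈Q v∈a v∉Q z∈b z∈Q w∈b w∉Q (separated p∈a p∉b)
        ; y∈Q = y∈Q ; y∈a = y∈a ; y∈b = y∈b
        ; p∈Q = p∈Q ; p~y = ~y p∈Q v∉Q v~p ; p∈a = p∈a ; p∉b = p∉b }
        where
        p∉b : p ∉ F b
        p∉b p∈b = clash (linkIn p∈b y∈b w∈b (~y p∈Q v∉Q v~p) (flip-adj (off-y w∉Q))) (flip-adj w≁p)

    one-sided-case : ∀ {v x y} → v ∉ Q → x ∈ Q → v ~ x → y ∈ Q → x ~ y → OneSided y →
      IsBicliqueGraph (delete G q)
    one-sided-case {v} v∉Q x∈Q v~x y∈Q x~y oneSided
      with any? (λ w → any? λ z → any? λ p → ¬? (w ∈? Q) ×-dec z ∈? Q ×-dec adj H w z ≟ᵇ true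
                   ×-dec p ∈? Q ×-dec ¬? (adj H w p ≟ᵇ adj H v p))
    ... | no none = uniform conn v∉Q x∈Q v~x y∈Q x~y oneSided λ w∉Q z∈Q w~z p∈Q →
      decidable-stable (_ ≟ᵇ _) λ w≢v → none (_ , _ , _ , w∉Q , z∈Q , w~z , p∈Q , w≢v)
    ... | yes (w , z , p , w∉Q , z∈Q , w~z , p∈Q , w≢v)
      with bool-cases (adj H v p) | bool-cases (adj H w p)
    ...   | inj₁ v~p | inj₂ w≁p = distinguished-case oneSided y∈Q v∉Q p∈Q v~p w∉Q w≁p z∈Q w~z
    -- `w` and `v` swap roles, and `x` becomes the witness that `v` attaches to `Q`.
    ...   | inj₂ v≁p | inj₁ w~p = distinguished-case oneSided y∈Q w∉Q p∈Q w~p v∉Q v≁p x∈Q v~x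
    ...   | inj₁ v~p | inj₁ w~p = contradiction (trans w~p (sym v~p)) w≢v
    ...   | inj₂ v≁p | inj₂ w≁p = contradiction (trans w≁p (sym v≁p)) w≢v

    boundary-case : ∀ {v x} → v ∉ Q → x ∈ Q → v ~ x → IsBicliqueGraph (delete G q)
    boundary-case {v} {x} v∉Q x∈Q v~x
      with any? (λ u → any? λ r → any? λ s → ¬? (u ∈? Q) ×-dec r ∈? Q ×-dec s ∈? Q
             ×-dec adj H r s ≟ᵇ true ×-dec adj H u r ≟ᵇ true ×-dec adj H u s ≟ᵇ true)
    ... | yes (u , r , s , u∉Q , r∈Q , s∈Q , r~s , u~r , u~s) =
      triangle-case u∉Q r∈Q s∈Q r~s u~r u~s
    ... | no flat with neighbour (bipartite q) x∈Q
    ...   | y , y∈Q , x~y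
      with any? (λ w → any? λ r → ¬? (w ∈? Q) ×-dec r ∈? Q ×-dec adj H w r ≟ᵇ true
             ×-dec adj H x r ≟ᵇ true)
    ...     | yes (w , r , w∉Q , r∈Q , w~r , x~r) =
      two-sided-case
        (λ u∉Q r∈Q s∈Q r~s u~r → ¬T⁻ λ u~s →
          flat (_ , _ , _ , u∉Q , r∈Q , s∈Q , r~s , u~r , T⁻ u~s))
        v∉Q x∈Q v~x w∉Q r∈Q w~r x~r
    ...     | no none = one-sided-case v∉Q x∈Q v~x y∈Q x~y λ w∉Q r∈Q r≁y →
      ¬T⁻ λ w~r → none (_ , _ , w∉Q , r∈Q , T⁻ w~r ,
        flip-adj (linkIn r∈Q y∈Q x∈Q r≁y (flip-adj x~y)))

    boundary : ∀ {a} → a ≢ q → ∃₂ λ v x → v ∉ Q × x ∈ Q × v ~ x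
    boundary {a} a≢q with any? (λ v → any? λ x → ¬? (v ∈? Q) ×-dec x ∈? Q ×-dec adj H v x ≟ᵇ true)
    ... | yes b = b
    -- With no edge leaving `Q`, connectivity makes `Q` everything, so `F a` would be contained in
    -- it.
    ... | no none = contradiction (antichain λ {u} _ → everything u) a≢q
      where
      closed : ∀ {u w} → u ∈ Q → u ~ w → w ∈ Q
      closed {u} {w} u∈Q u~w = decidable-stable (w ∈? Q) λ w∉Q →
        none (w , u , w∉Q , u∈Q , flip-adj u~w)
      everything : ∀ u → u ∈ Q
      everything u = reach-closed (_∈ Q) closed (conn _ u)
        (proj₁ (proj₂ (proj₂ (edge (bipartite q)))))

-- Degree two as a list of two neighbours.

count-true : ∀ {A : Set} (f : A → Bool) xs →
  sum (map (λ j → if f j then 1 else 0) xs) ≡ length (filter (T? ∘ f) xs)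
count-true f []       = refl
count-true f (x ∷ xs) with f x
... | true  = cong suc (count-true f xs)
... | false = count-true f xs

degree-two : ∀ {n} (G : Graph n) q → degree G q ≡ 2 → ∃₂ λ a b →
  adj G q a ≡ true × (∀ {j} → adj G q j ≡ true → j ≡ a ⊎ j ≡ b)
degree-two G q deg
  with filter (T? ∘ adj G q) (allFin _) in eq | trans (sym deg) (count-true (adj G q) (allFin _))
-- The length equation rules out every other shape of the list.
... | a ∷ b ∷ [] | _ = a , b ,
  T⁻ (proj₂ (∈-filter⁻ (T? ∘ adj G q) {xs = allFin _} (subst (a ∈ˡ_) (sym eq) (Any.here refl)))) ,
  λ q~j → pick (subst (_ ∈ˡ_) eq (∈-filter⁺ (T? ∘ adj G q) (∈-allFin _) (T⁺ q~j)))
  where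
  pick : ∀ {j} → j ∈ˡ a ∷ b ∷ [] → j ≡ a ⊎ j ≡ b
  pick (Any.here j≡a)             = inj₁ j≡a
  pick (Any.there (Any.here j≡b)) = inj₂ j≡b

-- Two distinct elements satisfying `P` are the listed pair in some order, so they can replace it.
at-most-two : ∀ {A : Set} {P : A → Set} {a b} → (∀ {j} → P j → j ≡ a ⊎ j ≡ b) →
  ∀ {i j k} → i ≢ j → P i → P j → P k → k ≡ i ⊎ k ≡ j
at-most-two only i≢j pi pj pk with only pi | only pj | only pk
... | inj₁ refl | inj₁ refl | _         = contradiction refl i≢j
... | inj₂ refl | inj₂ refl | _         = contradiction refl i≢j
... | inj₁ refl | inj₂ refl | k≡        = k≡
... | inj₂ refl | inj₁ refl | k≡        = swap k≡

theorem2 : {n m : ℕ} (H : Graph n) (G : Graph (suc m)) →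
    Connected H → IsoKB G H →
    (q : Fin (suc m)) → degree G q ≡ 2 →
    IsBicliqueGraph (delete G q)
theorem2 H G conn iso q deg =
  let a , b , q~a , only = degree-two G q deg
      two = at-most-two {P = λ j → adj G q j ≡ true} only
      _ , _ , v∉Q , x∈Q , v~x = boundary conn two (a≢q q~a)
  in boundary-case conn two v∉Q x∈Q v~x
  where
  R : Represents G H (proj₁ iso)
  R = isoKB⇒represents iso
  open Deletion R q
  a≢q : ∀ {a} → adj G q a ≡ true → a ≢ q
  a≢q q~a refl = clash q~a (irrefl G q)
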